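{- Let $d\ge 1$ and $n\ge 1$ be integers. Let $A$ be an $[n]^{d+1}$ array of zeros and ones, and for $(i_1,\dots,i_d)\in[n]^d$ let $r_{i_1,\dots,i_d}$ be the number of ones in the line $A(i_1,\dots,i_d,\ast)$, i.e. the number of $t\in[n]$ with $A(i_1,\dots,i_d,t)=1$; assume every $r_{i_1,\dots,i_d}\ge 1$. Then $$Per_d(A)\le \prod_{(i_1,\dots,i_d)\in[n]^d} e^{f(d,\,r_{i_1,\dots,i_d})},$$ where $f$ is defined recursively, for integers $d\ge 0$ and $r\ge 1$, by $f(0,r)=\log r$ (natural logarithm) and $f(d,r)=\frac1r\sum_{k=1}^r f(d-1,k)$ for $d\ge 1$.
   Context: Write $[n]=\{1,\dots,n\}$. A line of an $[n]^{m}$ array $P$ is a vector of the form $\big(P(i_1,\dots,i_{j-1},t,i_{j+1},\dots,i_m)\big)_{t=1}^n$, where $1\le j\le m$ and the other indices are fixed elements of $[n]$. A $d$-dimensional permutation of order $n$ is an $[n]^{d+1}$ array of zeros and ones in which every line contains exactly one entry equal to $1$. An $[n]^{d+1}$ 0-1 array $M_1$ supports an $[n]^{d+1}$ array $M_2$ if $M_2(i_1,\dots,i_{d+1})=1$ implies $M_1(i_1,\dots,i_{d+1})=1$. The $d$-permanent $Per_d(A)$ of an $[n]^{d+1}$ 0-1 array $A$ is the number of $d$-dimensional permutations of order $n$ supported by $A$. -}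

module Defs where

open import Data.Bool.Base using (Bool; true; false)
import Data.Bool.Properties as Bool
open import Data.Fin.Base as Fin using (Fin; toℕ; fromℕ)
import Data.Fin.Properties as Fin
import Data.Integer.Base as ℤ
import Data.Integer.Properties as ℤ
open import Data.List.Base as List using (List; []; _∷_)
open import Data.Nat.Base as ℕ using (ℕ; zero; suc)
import Data.Nat.Properties as ℕ
open import Data.Product.Base using (∃; _×_; _,_; proj₁; proj₂)
open import Data.Rational.Base
open import Data.Rational.Properties
open import Data.Rational.Solver using (module +-*-Solver)
import Data.Rational.Unnormalised.Base as ℚᵘ
import Data.Rational.Unnormalised.Properties as ℚᵘ
open import Data.Sum.Base using (inj₁; inj₂)
open import Data.Vec.Base as Vec using (Vec; []; _∷_)
open import Relation.Binary.PropositionalEquality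
open import Relation.Nullary.Decidable using (Dec; map′; _×-dec_; _→-dec_)
open import Relation.Unary using (Decidable)

open +-*-Solver using (solve; _:=_; _:+_; _:*_; _:-_; :-_)

private
  to-/ : ∀ n d → toℚᵘ (n / suc d) ℚᵘ.≃ ℚᵘ.mkℚᵘ n d
  to-/ n d = toℚᵘ-fromℚᵘ (ℚᵘ.mkℚᵘ n d)

-- Opaque, since unfolding the normalisation of fractions is costly.
opaque
  ι : ℕ → ℚ
  ι n = ℤ.+ n / 1

  recip : ℕ → ℚ
  recip n = ℤ.+ 1 / suc n

  ι-+ : ∀ m n → ι (m ℕ.+ n) ≡ ι m + ι n
  ι-+ m n = toℚᵘ-injective (begin
    toℚᵘ (ι (m ℕ.+ n))              ≈⟨ to-/ (ℤ.+ (m ℕ.+ n)) 0 ⟩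
    ℚᵘ.mkℚᵘ (ℤ.+ (m ℕ.+ n)) 0         ≈⟨ ℚᵘ.*≡* (cong (ℤ._* ℤ.+ 1)
                                         (cong₂ ℤ._+_ (sym (ℤ.*-identityʳ (ℤ.+ m))) (sym (ℤ.*-identityʳ (ℤ.+ n))))) ⟩
    ℚᵘ.mkℚᵘ (ℤ.+ m) 0 ℚᵘ.+ ℚᵘ.mkℚᵘ (ℤ.+ n) 0  ≈⟨ ℚᵘ.+-cong (to-/ (ℤ.+ m) 0) (to-/ (ℤ.+ n) 0) ⟨
    toℚᵘ (ι m) ℚᵘ.+ toℚᵘ (ι n)      ≈⟨ toℚᵘ-homo-+ (ι m) (ι n) ⟨
    toℚᵘ (ι m + ι n)                ∎)
    where open ℚᵘ.≃-Reasoning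

  ι-* : ∀ m n → ι (m ℕ.* n) ≡ ι m * ι n
  ι-* m n = toℚᵘ-injective (begin
    toℚᵘ (ι (m ℕ.* n))              ≈⟨ to-/ (ℤ.+ (m ℕ.* n)) 0 ⟩
    ℚᵘ.mkℚᵘ (ℤ.+ (m ℕ.* n)) 0         ≈⟨ ℚᵘ.*≡* (cong (ℤ._* ℤ.+ 1) (ℤ.pos-* m n)) ⟩
    ℚᵘ.mkℚᵘ (ℤ.+ m) 0 ℚᵘ.* ℚᵘ.mkℚᵘ (ℤ.+ n) 0  ≈⟨ ℚᵘ.*-cong (to-/ (ℤ.+ m) 0) (to-/ (ℤ.+ n) 0) ⟨
    toℚᵘ (ι m) ℚᵘ.* toℚᵘ (ι n)      ≈⟨ toℚᵘ-homo-* (ι m) (ι n) ⟨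
    toℚᵘ (ι m * ι n)                ∎)
    where open ℚᵘ.≃-Reasoning

  ι-recip : ∀ n → ι (suc n) * recip n ≡ 1ℚ
  ι-recip n = toℚᵘ-injective (begin
    toℚᵘ (ι (suc n) * recip n)                    ≈⟨ toℚᵘ-homo-* (ι (suc n)) (recip n) ⟩
    toℚᵘ (ι (suc n)) ℚᵘ.* toℚᵘ (recip n)          ≈⟨ ℚᵘ.*-cong (to-/ (ℤ.+ suc n) 0) (to-/ (ℤ.+ 1) n) ⟩
    ℚᵘ.mkℚᵘ (ℤ.+ suc n) 0 ℚᵘ.* ℚᵘ.mkℚᵘ (ℤ.+ 1) n      ≈⟨ ℚᵘ.*≡* (trans (ℤ.*-identityʳ (ℤ.+ suc n ℤ.* ℤ.+ 1))
                                                       (trans (ℤ.*-comm (ℤ.+ suc n) (ℤ.+ 1))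
                                                       (cong (λ k → ℤ.+ 1 ℤ.* ℤ.+ suc k) (sym (ℕ.+-identityʳ n))))) ⟩
    toℚᵘ 1ℚ                                       ∎)
    where open ℚᵘ.≃-Reasoning

  ι-mono : ∀ {m n} → m ℕ.≤ n → ι m ≤ ι n
  ι-mono {m} {n} m≤n = toℚᵘ-cancel-≤ (begin
    toℚᵘ (ι m)       ≃⟨ to-/ (ℤ.+ m) 0 ⟩
    ℚᵘ.mkℚᵘ (ℤ.+ m) 0  ≤⟨ ℚᵘ.*≤* (ℤ.*-monoʳ-≤-nonNeg (ℤ.+ 1) (ℤ.+≤+ m≤n)) ⟩
    ℚᵘ.mkℚᵘ (ℤ.+ n) 0  ≃⟨ to-/ (ℤ.+ n) 0 ⟨
    toℚᵘ (ι n)       ∎)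
    where open ℚᵘ.≤-Reasoning

  recip-anti : ∀ {m n} → m ℕ.≤ n → recip n ≤ recip m
  recip-anti {m} {n} m≤n = toℚᵘ-cancel-≤ (begin
    toℚᵘ (recip n)   ≃⟨ to-/ (ℤ.+ 1) n ⟩
    ℚᵘ.mkℚᵘ (ℤ.+ 1) n  ≤⟨ ℚᵘ.*≤* (ℤ.*-monoˡ-≤-nonNeg (ℤ.+ 1) (ℤ.+≤+ (ℕ.s≤s m≤n))) ⟩
    ℚᵘ.mkℚᵘ (ℤ.+ 1) m  ≃⟨ to-/ (ℤ.+ 1) m ⟨
    toℚᵘ (recip m)   ∎)
    where open ℚᵘ.≤-Reasoning

  recip-pos : ∀ n → Positive (recip n)
  recip-pos n = normalize-pos 1 (suc n)

  0≤ι : ∀ n → 0ℚ ≤ ι n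
  0≤ι n = nonNegative⁻¹ (ι n) {{normalize-nonNeg n 1}}

  0≤recip : ∀ n → 0ℚ ≤ recip n
  0≤recip n = nonNegative⁻¹ (recip n) {{pos⇒nonNeg (recip n) {{recip-pos n}}}}

  ι-0 : ι 0 ≡ 0ℚ
  ι-0 = refl

  ι-suc : ∀ n → ι (suc n) ≡ 1ℚ + ι n
  ι-suc n = ι-+ 1 n

  recip-0 : recip 0 ≡ 1ℚ
  recip-0 = refl

  archimedes : ∀ p → ∃ λ n → p ≤ ι (suc n)
  archimedes p@(mkℚ i d _) = ℤ.∣ i ∣ , toℚᵘ-cancel-≤ (begin
    ℚᵘ.mkℚᵘ i d                       ≤⟨ ℚᵘ.*≤* ineq ⟩
    ℚᵘ.mkℚᵘ (ℤ.+ suc ℤ.∣ i ∣) 0         ≃⟨ to-/ (ℤ.+ suc ℤ.∣ i ∣) 0 ⟨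
    toℚᵘ (ι (suc ℤ.∣ i ∣))            ∎)
    where
    i≤∣i∣ : ∀ i → i ℤ.≤ ℤ.+ ℤ.∣ i ∣
    i≤∣i∣ (ℤ.+ n)       = ℤ.≤-refl
    i≤∣i∣ (ℤ.-[1+ n ]) = ℤ.-≤+
    ineq : i ℤ.* ℤ.+ 1 ℤ.≤ ℤ.+ suc ℤ.∣ i ∣ ℤ.* ℤ.+ suc d
    ineq = subst₂ ℤ._≤_ (sym (ℤ.*-identityʳ i)) (ℤ.pos-* (suc ℤ.∣ i ∣) (suc d))
      (ℤ.≤-trans (i≤∣i∣ i)
        (ℤ.+≤+ (ℕ.≤-trans (ℕ.n≤1+n _) (ℕ.m≤m*n (suc ℤ.∣ i ∣) (suc d)))))
    open ℚᵘ.≤-Reasoning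

*-monoˡ : ∀ {r p q} → 0ℚ ≤ r → p ≤ q → r * p ≤ r * q
*-monoˡ {r} 0≤r = *-monoˡ-≤-nonNeg r {{nonNegative 0≤r}}

*-monoʳ : ∀ {r p q} → 0ℚ ≤ r → p ≤ q → p * r ≤ q * r
*-monoʳ {r} 0≤r = *-monoʳ-≤-nonNeg r {{nonNegative 0≤r}}

*-mono : ∀ {p q r s} → 0ℚ ≤ q → 0ℚ ≤ r → p ≤ q → r ≤ s → p * r ≤ q * s
*-mono 0≤q 0≤r p≤q r≤s = ≤-trans (*-monoʳ 0≤r p≤q) (*-monoˡ 0≤q r≤s)

*-nonNeg : ∀ {p q} → 0ℚ ≤ p → 0ℚ ≤ q → 0ℚ ≤ p * q
*-nonNeg {p} {q} 0≤p 0≤q = subst (_≤ p * q) (*-zeroʳ p) (*-monoˡ 0≤p 0≤q)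

+-nonNeg : ∀ {p q} → 0ℚ ≤ p → 0ℚ ≤ q → 0ℚ ≤ p + q
+-nonNeg = +-mono-≤

p≤p+q : ∀ {p q} → 0ℚ ≤ q → p ≤ p + q
p≤p+q {p} {q} 0≤q = subst (_≤ p + q) (+-identityʳ p) (+-monoʳ-≤ p 0≤q)

q≤p+q : ∀ {p q} → 0ℚ ≤ p → q ≤ p + q
q≤p+q {p} {q} 0≤p = subst (_≤ p + q) (+-identityˡ q) (+-monoˡ-≤ q 0≤p)

opaque
  shrink : ∀ C {ε} → 0ℚ < ε → ∃ λ δ → 0ℚ < δ × C * δ ≤ ε
  shrink C {ε} 0<ε with archimedes C
  ... | c , C≤ = δ , positive⁻¹ δ {{pos*pos⇒pos ε {{positive 0<ε}} (recip c) {{recip-pos c}}}} , (begin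
    C * δ                      ≤⟨ *-monoʳ (*-nonNeg (<⇒≤ 0<ε) (0≤recip c)) C≤ ⟩
    ι (suc c) * (ε * recip c)  ≡⟨ solve 3 (λ a e b → a :* (e :* b) := e :* (a :* b)) refl (ι (suc c)) ε (recip c) ⟩
    ε * (ι (suc c) * recip c)  ≡⟨ cong (ε *_) (ι-recip c) ⟩
    ε * 1ℚ                     ≡⟨ *-identityʳ ε ⟩
    ε                          ∎)
    where
    open ≤-Reasoning
    δ : ℚ
    δ = ε * recip c

  eventually-small : ∀ C {ε} → 0ℚ < ε → ∃ λ n → C * recip n ≤ ε
  eventually-small C {ε} 0<ε = n , (begin
    C * recip n                     ≡⟨ cong (_* recip n) (*-identityʳ C) ⟨
    C * 1ℚ * recip n                ≡⟨ cong (λ z → C * z * recip n) (*-inverseʳ ε) ⟨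
    C * (ε * 1/ ε) * recip n        ≡⟨ solve 4 (λ c e f r → c :* (e :* f) :* r := e :* ((c :* f) :* r)) refl C ε (1/ ε) (recip n) ⟩
    ε * ((C * 1/ ε) * recip n)      ≤⟨ *-monoˡ (<⇒≤ 0<ε) (*-monoʳ (0≤recip n) (proj₂ a)) ⟩
    ε * (ι (suc n) * recip n)       ≡⟨ cong (ε *_) (ι-recip n) ⟩
    ε * 1ℚ                          ≡⟨ *-identityʳ ε ⟩
    ε                               ∎)
    where
    open ≤-Reasoning
    instance
      ε≢0 : NonZero ε
      ε≢0 = >-nonZero 0<ε
    a : ∃ λ n → C * 1/ ε ≤ ι (suc n)
    a = archimedes (C * 1/ ε)
    n : ℕ
    n = proj₁ a

dist-sym : ∀ p q → ∣ p - q ∣ ≡ ∣ q - p ∣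
dist-sym p q = trans (sym (∣-p∣≡∣p∣ (p - q)))
  (cong ∣_∣ (solve 2 (λ a b → :- (a :- b) := b :- a) refl p q))

triangle : ∀ p q r → ∣ p - r ∣ ≤ ∣ p - q ∣ + ∣ q - r ∣
triangle p q r = subst (λ z → ∣ z ∣ ≤ ∣ p - q ∣ + ∣ q - r ∣)
  (solve 3 (λ a b c → (a :- b) :+ (b :- c) := a :- c) refl p q r)
  (∣p+q∣≤∣p∣+∣q∣ (p - q) (q - r))

dist-of-≤ : ∀ {p q} → q ≤ p → ∣ p - q ∣ ≡ p - q
dist-of-≤ {p} {q} q≤p = 0≤p⇒∣p∣≡p (subst (_≤ p - q) (+-inverseʳ q) (+-monoˡ-≤ (- q) q≤p))

Cauchy : (ℕ → ℚ) → Set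
Cauchy a = ∀ ε → 0ℚ < ε →
  ∃ λ N → ∀ m n → N ℕ.≤ m → N ℕ.≤ n → ∣ a m - a n ∣ ≤ ε

-- Equality of reals is not identity of sequences; x and y denote the same real
-- when x ≤ℝ y and y ≤ℝ x.
record ℝ : Set where
  constructor mkℝ
  field
    seq    : ℕ → ℚ
    cauchy : Cauchy seq

open ℝ public

infix 4 _≤ℝ_

-- Equivalent to ¬ (y < x) for the usual strict order.
_≤ℝ_ : ℝ → ℝ → Set
x ≤ℝ y = ∀ ε → 0ℚ < ε → ∃ λ N → ∀ n → N ℕ.≤ n → seq x n ≤ seq y n + ε

-- It is enough to control ordered pairs of indices, up to a constant factor.
cauchy-intro : ∀ a C →
  (∀ ε → 0ℚ < ε → ∃ λ N → ∀ m n → N ℕ.≤ n → n ℕ.≤ m → ∣ a m - a n ∣ ≤ C * ε) →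
  Cauchy a
cauchy-intro a C H ε 0<ε = N , λ m n N≤m N≤n → ≤-trans (close m n N≤m N≤n) Cδ≤ε
  where
  δ : ℚ
  δ = proj₁ (shrink C 0<ε)
  Cδ≤ε : C * δ ≤ ε
  Cδ≤ε = proj₂ (proj₂ (shrink C 0<ε))
  Hδ : ∃ λ N → ∀ m n → N ℕ.≤ n → n ℕ.≤ m → ∣ a m - a n ∣ ≤ C * δ
  Hδ = H δ (proj₁ (proj₂ (shrink C 0<ε)))
  N : ℕ
  N = proj₁ Hδ
  close : ∀ m n → N ℕ.≤ m → N ℕ.≤ n → ∣ a m - a n ∣ ≤ C * δ
  close m n N≤m N≤n with ℕ.≤-total n m
  ... | inj₁ n≤m = proj₂ Hδ m n N≤n n≤m
  ... | inj₂ m≤n = subst (_≤ C * δ) (dist-sym (a n) (a m)) (proj₂ Hδ n m N≤m m≤n)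

absSum : (ℕ → ℚ) → ℕ → ℚ
absSum a zero    = 0ℚ
absSum a (suc n) = absSum a n + ∣ a n ∣

0≤absSum : ∀ a n → 0ℚ ≤ absSum a n
0≤absSum a zero    = ≤-refl
0≤absSum a (suc n) = +-nonNeg (0≤absSum a n) (0≤∣p∣ (a n))

absSum-bound : ∀ a {i n} → i ℕ.<′ n → ∣ a i ∣ ≤ absSum a n
absSum-bound a {i} (ℕ.≤′-reflexive refl) = q≤p+q (0≤absSum a i)
absSum-bound a {i} (ℕ.≤′-step i<n)  = ≤-trans (absSum-bound a i<n) (p≤p+q (0≤∣p∣ (a _)))

opaque
  cauchy-bounded : ∀ {a} → Cauchy a → ∃ λ B → 0ℚ ≤ B × (∀ n → ∣ a n ∣ ≤ B)
  cauchy-bounded {a} ca with ca 1ℚ (positive⁻¹ 1ℚ)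
  ... | N , h = S + 1ℚ , +-nonNeg (0≤absSum a (suc N)) (nonNegative⁻¹ 1ℚ) , bound
    where
    S : ℚ
    S = absSum a (suc N)
    bound : ∀ n → ∣ a n ∣ ≤ S + 1ℚ
    bound n with ℕ.≤-total n N
    ... | inj₁ n≤N = ≤-trans (absSum-bound a (ℕ.≤⇒≤′ (ℕ.s≤s n≤N))) (p≤p+q (nonNegative⁻¹ 1ℚ))
    ... | inj₂ N≤n = begin
      ∣ a n ∣                    ≡⟨ cong ∣_∣ (solve 2 (λ p q → p := q :+ (p :- q)) refl (a n) (a N)) ⟩
      ∣ a N + (a n - a N) ∣      ≤⟨ ∣p+q∣≤∣p∣+∣q∣ (a N) (a n - a N) ⟩
      ∣ a N ∣ + ∣ a n - a N ∣    ≤⟨ +-mono-≤ (absSum-bound a (ℕ.≤⇒≤′ ℕ.≤-refl)) (h n N N≤n ℕ.≤-refl) ⟩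
      S + 1ℚ                     ∎
      where open ≤-Reasoning

fromℚ : ℚ → ℝ
fromℚ q = mkℝ (λ _ → q) λ ε 0<ε → 0 , λ _ _ _ _ →
  subst (_≤ ε) (sym (cong ∣_∣ (+-inverseʳ q))) (<⇒≤ 0<ε)

fromℕℝ : ℕ → ℝ
fromℕℝ n = fromℚ (ι n)

infixl 6 _+ℝ_
infixl 7 _*ℝ_

_+ℝ_ : ℝ → ℝ → ℝ
mkℝ a ca +ℝ mkℝ b cb = mkℝ (λ n → a n + b n) (cauchy-intro (λ n → a n + b n) (1ℚ + 1ℚ) close)
  where
  close : ∀ ε → 0ℚ < ε → ∃ λ N → ∀ m n → N ℕ.≤ n → n ℕ.≤ m →
          ∣ a m + b m - (a n + b n) ∣ ≤ (1ℚ + 1ℚ) * ε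
  close ε 0<ε with ca ε 0<ε | cb ε 0<ε
  ... | M , hM | N , hN = M ℕ.⊔ N , λ m n le n≤m →
    let M≤n = ℕ.m⊔n≤o⇒m≤o M N le ; N≤n = ℕ.m⊔n≤o⇒n≤o M N le in begin
    ∣ a m + b m - (a n + b n) ∣        ≡⟨ cong ∣_∣ (solve 4 (λ p q r s → p :+ q :- (r :+ s) := (p :- r) :+ (q :- s)) refl (a m) (b m) (a n) (b n)) ⟩
    ∣ (a m - a n) + (b m - b n) ∣      ≤⟨ ∣p+q∣≤∣p∣+∣q∣ (a m - a n) (b m - b n) ⟩
    ∣ a m - a n ∣ + ∣ b m - b n ∣      ≤⟨ +-mono-≤ (hM m n (ℕ.≤-trans M≤n n≤m) M≤n) (hN m n (ℕ.≤-trans N≤n n≤m) N≤n) ⟩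
    ε + ε                              ≡⟨ cong₂ _+_ (*-identityˡ ε) (*-identityˡ ε) ⟨
    1ℚ * ε + 1ℚ * ε                    ≡⟨ *-distribʳ-+ ε 1ℚ 1ℚ ⟨
    (1ℚ + 1ℚ) * ε                      ∎
    where open ≤-Reasoning

_*ℝ_ : ℝ → ℝ → ℝ
mkℝ a ca *ℝ mkℝ b cb = mkℝ (λ n → a n * b n) (build (cauchy-bounded ca) (cauchy-bounded cb))
  where
  build : (∃ λ A → 0ℚ ≤ A × (∀ n → ∣ a n ∣ ≤ A)) → (∃ λ B → 0ℚ ≤ B × (∀ n → ∣ b n ∣ ≤ B)) →
          Cauchy (λ n → a n * b n)
  build (A , 0≤A , ∣a∣≤A) (B , 0≤B , ∣b∣≤B) = cauchy-intro (λ n → a n * b n) (A + B) close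
    where
    close : ∀ ε → 0ℚ < ε → ∃ λ N → ∀ m n → N ℕ.≤ n → n ℕ.≤ m →
            ∣ a m * b m - a n * b n ∣ ≤ (A + B) * ε
    close ε 0<ε with ca ε 0<ε | cb ε 0<ε
    ... | M , hM | N , hN = M ℕ.⊔ N , λ m n le n≤m →
      let M≤n = ℕ.m⊔n≤o⇒m≤o M N le ; N≤n = ℕ.m⊔n≤o⇒n≤o M N le in begin
      ∣ a m * b m - a n * b n ∣                        ≡⟨ cong ∣_∣ (solve 4 (λ p q r s → p :* q :- r :* s := p :* (q :- s) :+ s :* (p :- r)) refl (a m) (b m) (a n) (b n)) ⟩
      ∣ a m * (b m - b n) + b n * (a m - a n) ∣        ≤⟨ ∣p+q∣≤∣p∣+∣q∣ (a m * (b m - b n)) (b n * (a m - a n)) ⟩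
      ∣ a m * (b m - b n) ∣ + ∣ b n * (a m - a n) ∣    ≡⟨ cong₂ _+_ (∣p*q∣≡∣p∣*∣q∣ (a m) (b m - b n)) (∣p*q∣≡∣p∣*∣q∣ (b n) (a m - a n)) ⟩
      ∣ a m ∣ * ∣ b m - b n ∣ + ∣ b n ∣ * ∣ a m - a n ∣ ≤⟨ +-mono-≤ (*-mono 0≤A (0≤∣p∣ (b m - b n)) (∣a∣≤A m) (hN m n (ℕ.≤-trans N≤n n≤m) N≤n))
                                                                 (*-mono 0≤B (0≤∣p∣ (a m - a n)) (∣b∣≤B n) (hM m n (ℕ.≤-trans M≤n n≤m) M≤n)) ⟩
      A * ε + B * ε                                    ≡⟨ *-distribʳ-+ ε A B ⟨
      (A + B) * ε                                      ∎
      where open ≤-Reasoning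

increasing : ∀ {a : ℕ → ℚ} {K} → (∀ n → K ℕ.≤ n → a n ≤ a (suc n)) →
  ∀ {n m} → K ℕ.≤ n → n ℕ.≤ m → a n ≤ a m
increasing {a} {K} step K≤n n≤m = go K≤n (ℕ.≤⇒≤′ n≤m)
  where
  go : ∀ {n m} → K ℕ.≤ n → n ℕ.≤′ m → a n ≤ a m
  go K≤n (ℕ.≤′-reflexive refl) = ≤-refl
  go K≤n (ℕ.≤′-step n≤m) = ≤-trans (go K≤n n≤m)
    (step _ (ℕ.≤-trans K≤n (ℕ.≤′⇒≤ n≤m)))

decreasing : ∀ {a : ℕ → ℚ} {K} → (∀ n → K ℕ.≤ n → a (suc n) ≤ a n) →
  ∀ {n m} → K ℕ.≤ n → n ℕ.≤ m → a m ≤ a n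
decreasing {a} {K} step K≤n n≤m = go K≤n (ℕ.≤⇒≤′ n≤m)
  where
  go : ∀ {n m} → K ℕ.≤ n → n ℕ.≤′ m → a m ≤ a n
  go K≤n (ℕ.≤′-reflexive refl) = ≤-refl
  go K≤n (ℕ.≤′-step n≤m) = ≤-trans
    (step _ (ℕ.≤-trans K≤n (ℕ.≤′⇒≤ n≤m))) (go K≤n n≤m)

-- If a increases and a + b decreases then later terms stay within b n of a n.
squeeze : ∀ {a b : ℕ → ℚ} {K} →
  (∀ n → K ℕ.≤ n → a (suc n) + b (suc n) ≤ a n + b n) → (∀ n → 0ℚ ≤ b n) →
  ∀ {n m} → K ℕ.≤ n → n ℕ.≤ m → a m - a n ≤ b n
squeeze {a} {b} dec 0≤b {n} {m} K≤n n≤m = begin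
  a m - a n          ≤⟨ +-monoˡ-≤ (- a n) (≤-trans (p≤p+q {a m} (0≤b m)) (decreasing {λ k → a k + b k} dec K≤n n≤m)) ⟩
  a n + b n - a n    ≡⟨ solve 2 (λ p q → p :+ q :- p := q) refl (a n) (b n) ⟩
  b n                ∎
  where open ≤-Reasoning

-- x ^ k / k !
expTerm : ℚ → ℕ → ℚ
expTerm x zero    = 1ℚ
expTerm x (suc k) = expTerm x k * (x * recip k)

expSum : ℚ → ℕ → ℚ
expSum x zero    = 0ℚ
expSum x (suc n) = expSum x n + expTerm x n

module _ {B : ℚ} (0≤B : 0ℚ ≤ B) where

  0≤expTerm : ∀ k → 0ℚ ≤ expTerm B k
  0≤expTerm zero    = nonNegative⁻¹ 1ℚ
  0≤expTerm (suc k) = *-nonNeg (0≤expTerm k) (*-nonNeg 0≤B (0≤recip k))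

  0≤expSum : ∀ n → 0ℚ ≤ expSum B n
  0≤expSum zero    = ≤-refl
  0≤expSum (suc n) = +-nonNeg (0≤expSum n) (0≤expTerm n)

  expSum-mono : ∀ {n m} → n ℕ.≤ m → expSum B n ≤ expSum B m
  expSum-mono = increasing (λ n _ → p≤p+q (0≤expTerm n)) ℕ.z≤n

  ∣expTerm∣≤ : ∀ {x} → ∣ x ∣ ≤ B → ∀ k → ∣ expTerm x k ∣ ≤ expTerm B k
  ∣expTerm∣≤     ∣x∣≤B zero    = ≤-refl
  ∣expTerm∣≤ {x} ∣x∣≤B (suc k) = begin
    ∣ expTerm x k * (x * recip k) ∣        ≡⟨ ∣p*q∣≡∣p∣*∣q∣ (expTerm x k) (x * recip k) ⟩
    ∣ expTerm x k ∣ * ∣ x * recip k ∣      ≡⟨ cong (∣ expTerm x k ∣ *_) (trans (∣p*q∣≡∣p∣*∣q∣ x (recip k)) (cong (∣ x ∣ *_) (0≤p⇒∣p∣≡p (0≤recip k)))) ⟩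
    ∣ expTerm x k ∣ * (∣ x ∣ * recip k)    ≤⟨ *-mono (0≤expTerm k) (*-nonNeg (0≤∣p∣ x) (0≤recip k)) (∣expTerm∣≤ ∣x∣≤B k) (*-monoʳ (0≤recip k) ∣x∣≤B) ⟩
    expTerm B k * (B * recip k)            ∎
    where open ≤-Reasoning

  expSum-tail : ∀ {x n m} → ∣ x ∣ ≤ B → n ℕ.≤ m →
    ∣ expSum x m - expSum x n ∣ ≤ expSum B m - expSum B n
  expSum-tail {x} ∣x∣≤B n≤m = go (ℕ.≤⇒≤′ n≤m)
    where
    open ≤-Reasoning
    go : ∀ {n m} → n ℕ.≤′ m → ∣ expSum x m - expSum x n ∣ ≤ expSum B m - expSum B n
    go {n} (ℕ.≤′-reflexive refl) = ≤-reflexive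
      (trans (cong ∣_∣ (+-inverseʳ (expSum x n))) (sym (+-inverseʳ (expSum B n))))
    go {n} (ℕ.≤′-step {m} n≤m) = begin
      ∣ expSum x m + expTerm x m - expSum x n ∣          ≡⟨ cong ∣_∣ (solve 3 (λ p q r → p :+ q :- r := (p :- r) :+ q) refl (expSum x m) (expTerm x m) (expSum x n)) ⟩
      ∣ expSum x m - expSum x n + expTerm x m ∣          ≤⟨ ∣p+q∣≤∣p∣+∣q∣ (expSum x m - expSum x n) (expTerm x m) ⟩
      ∣ expSum x m - expSum x n ∣ + ∣ expTerm x m ∣      ≤⟨ +-mono-≤ (go n≤m) (∣expTerm∣≤ ∣x∣≤B m) ⟩
      expSum B m - expSum B n + expTerm B m              ≡⟨ solve 3 (λ p q r → p :+ q :- r := (p :- r) :+ q) refl (expSum B m) (expTerm B m) (expSum B n) ⟨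
      expSum B m + expTerm B m - expSum B n              ∎

  expTerm-lipschitz : ∀ {x y} → ∣ x ∣ ≤ B → ∣ y ∣ ≤ B → ∀ k →
    ∣ expTerm x (suc k) - expTerm y (suc k) ∣ ≤ ∣ x - y ∣ * expTerm B k
  expTerm-lipschitz {x} {y} _ _ zero = ≤-reflexive (begin
    ∣ 1ℚ * (x * recip 0) - 1ℚ * (y * recip 0) ∣    ≡⟨ cong (λ r → ∣ 1ℚ * (x * r) - 1ℚ * (y * r) ∣) recip-0 ⟩
    ∣ 1ℚ * (x * 1ℚ) - 1ℚ * (y * 1ℚ) ∣    ≡⟨ cong₂ (λ p q → ∣ p - q ∣) (trans (*-identityˡ (x * 1ℚ)) (*-identityʳ x)) (trans (*-identityˡ (y * 1ℚ)) (*-identityʳ y)) ⟩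
    ∣ x - y ∣                            ≡⟨ *-identityʳ ∣ x - y ∣ ⟨
    ∣ x - y ∣ * 1ℚ                       ∎)
    where open ≡-Reasoning
  expTerm-lipschitz {x} {y} ∣x∣≤B ∣y∣≤B (suc k) = begin
    ∣ s * (x * r′) - t * (y * r′) ∣            ≡⟨ cong ∣_∣ (solve 5 (λ s t x y r → s :* (x :* r) :- t :* (y :* r) := ((s :- t) :* x :+ t :* (x :- y)) :* r) refl s t x y r′) ⟩
    ∣ ((s - t) * x + t * (x - y)) * r′ ∣       ≡⟨ ∣p*q∣≡∣p∣*∣q∣ ((s - t) * x + t * (x - y)) r′ ⟩
    ∣ (s - t) * x + t * (x - y) ∣ * ∣ r′ ∣     ≡⟨ cong (∣ (s - t) * x + t * (x - y) ∣ *_) (0≤p⇒∣p∣≡p (0≤recip (suc k))) ⟩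
    ∣ (s - t) * x + t * (x - y) ∣ * r′         ≤⟨ *-monoʳ (0≤recip (suc k)) (∣p+q∣≤∣p∣+∣q∣ ((s - t) * x) (t * (x - y))) ⟩
    (∣ (s - t) * x ∣ + ∣ t * (x - y) ∣) * r′   ≡⟨ cong (_* r′) (cong₂ _+_ (∣p*q∣≡∣p∣*∣q∣ (s - t) x) (∣p*q∣≡∣p∣*∣q∣ t (x - y))) ⟩
    (∣ s - t ∣ * ∣ x ∣ + ∣ t ∣ * d) * r′       ≤⟨ *-monoʳ (0≤recip (suc k)) (+-mono-≤
                                                   (*-mono (*-nonNeg 0≤d (0≤expTerm k)) (0≤∣p∣ x) (expTerm-lipschitz ∣x∣≤B ∣y∣≤B k) ∣x∣≤B)
                                                   (*-monoʳ 0≤d (∣expTerm∣≤ ∣y∣≤B (suc k)))) ⟩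
    (d * u * B + v * d) * r′                   ≡⟨ cong (λ z → (z + v * d) * r′) dropped ⟩
    (d * (ι (suc k) * v) + v * d) * r′         ≡⟨ cong (λ z → (d * (ι (suc k) * v) + z) * r′) (trans (*-comm v d) (cong (d *_) (sym (*-identityˡ v)))) ⟩
    (d * (ι (suc k) * v) + d * (1ℚ * v)) * r′  ≡⟨ solve 5 (λ d i v o r → (d :* (i :* v) :+ d :* (o :* v)) :* r := d :* v :* ((o :+ i) :* r)) refl d (ι (suc k)) v 1ℚ r′ ⟩
    d * v * ((1ℚ + ι (suc k)) * r′)            ≡⟨ cong (λ z → d * v * (z * r′)) (ι-suc (suc k)) ⟨
    d * v * (ι (suc (suc k)) * r′)             ≡⟨ cong (d * v *_) (ι-recip (suc k)) ⟩
    d * v * 1ℚ                                 ≡⟨ *-identityʳ (d * v) ⟩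
    d * v                                      ∎
    where
    open ≤-Reasoning
    s t u v d r′ : ℚ
    s  = expTerm x (suc k)
    t  = expTerm y (suc k)
    u  = expTerm B k
    v  = expTerm B (suc k)
    d  = ∣ x - y ∣
    r′ = recip (suc k)
    0≤d : 0ℚ ≤ d
    0≤d = 0≤∣p∣ (x - y)
    dropped : d * u * B ≡ d * (ι (suc k) * v)
    dropped = begin-equality
      d * u * B                                ≡⟨ *-identityʳ (d * u * B) ⟨
      d * u * B * 1ℚ                           ≡⟨ cong (d * u * B *_) (ι-recip k) ⟨
      d * u * B * (ι (suc k) * recip k)        ≡⟨ solve 5 (λ d u b i r → d :* u :* b :* (i :* r) := d :* (i :* (u :* (b :* r)))) refl d u B (ι (suc k)) (recip k) ⟩
      d * (ι (suc k) * v)                      ∎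

  expSum-lipschitz : ∀ {x y} → ∣ x ∣ ≤ B → ∣ y ∣ ≤ B → ∀ n →
    ∣ expSum x n - expSum y n ∣ ≤ ∣ x - y ∣ * expSum B n
  expSum-lipschitz {x} {y} ∣x∣≤B ∣y∣≤B = λ where
      zero    → ≤-reflexive (sym (*-zeroʳ ∣ x - y ∣))
      (suc n) → ≤-trans (shifted n) (*-monoˡ (0≤∣p∣ (x - y)) (p≤p+q (0≤expTerm n)))
    where
    open ≤-Reasoning
    shifted : ∀ n → ∣ expSum x (suc n) - expSum y (suc n) ∣ ≤ ∣ x - y ∣ * expSum B n
    shifted zero    = ≤-reflexive (sym (*-zeroʳ ∣ x - y ∣))
    shifted (suc n) = begin
      ∣ p + q - (r + s) ∣              ≡⟨ cong ∣_∣ (solve 4 (λ p q r s → p :+ q :- (r :+ s) := (p :- r) :+ (q :- s)) refl p q r s) ⟩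
      ∣ (p - r) + (q - s) ∣            ≤⟨ ∣p+q∣≤∣p∣+∣q∣ (p - r) (q - s) ⟩
      ∣ p - r ∣ + ∣ q - s ∣            ≤⟨ +-mono-≤ (shifted n) (expTerm-lipschitz ∣x∣≤B ∣y∣≤B n) ⟩
      ∣ x - y ∣ * expSum B n + ∣ x - y ∣ * expTerm B n  ≡⟨ *-distribˡ-+ ∣ x - y ∣ (expSum B n) (expTerm B n) ⟨
      ∣ x - y ∣ * expSum B (suc n)     ∎
      where
      p q r s : ℚ
      p = expSum x (suc n)
      q = expTerm x (suc n)
      r = expSum y (suc n)
      s = expTerm y (suc n)

  -- From the index K on, each term is at most half of its predecessor.
  private
    K : ℕ
    K = proj₁ (archimedes (B + B))

  expTerm-halves : ∀ n → K ℕ.≤ n → expTerm B (suc n) + expTerm B (suc n) ≤ expTerm B n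
  expTerm-halves n K≤n = begin
    t * (B * recip n) + t * (B * recip n)    ≡⟨ solve 3 (λ t b r → t :* (b :* r) :+ t :* (b :* r) := t :* ((b :+ b) :* r)) refl t B (recip n) ⟩
    t * ((B + B) * recip n)                  ≤⟨ *-monoˡ (0≤expTerm n) (*-monoʳ (0≤recip n) (≤-trans (proj₂ (archimedes (B + B))) (ι-mono (ℕ.s≤s K≤n)))) ⟩
    t * (ι (suc n) * recip n)                ≡⟨ cong (t *_) (ι-recip n) ⟩
    t * 1ℚ                                   ≡⟨ *-identityʳ t ⟩
    t                                        ∎
    where
    open ≤-Reasoning
    t = expTerm B n

  expSum-squeeze : ∀ {n m} → K ℕ.≤ n → n ℕ.≤ m →
    expSum B m - expSum B n ≤ expTerm B n + expTerm B n
  expSum-squeeze = squeeze {expSum B} {λ n → expTerm B n + expTerm B n}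
    (λ n K≤n → ≤-trans
      (+-monoʳ-≤ (expSum B n + expTerm B n) (expTerm-halves n K≤n))
      (≤-reflexive (+-assoc (expSum B n) (expTerm B n) (expTerm B n))))
    (λ n → +-nonNeg (0≤expTerm n) (0≤expTerm n))

  expSum-bounded : ∃ λ D → ∀ n → expSum B n ≤ D
  expSum-bounded = D , bound
    where
    open ≤-Reasoning
    T D : ℚ
    T = expTerm B K + expTerm B K
    D = expSum B K + T
    bound : ∀ n → expSum B n ≤ D
    bound n with ℕ.≤-total n K
    ... | inj₁ n≤K = ≤-trans (expSum-mono n≤K) (p≤p+q (+-nonNeg (0≤expTerm K) (0≤expTerm K)))
    ... | inj₂ K≤n = begin
      expSum B n                               ≡⟨ solve 2 (λ p q → p := q :+ (p :- q)) refl (expSum B n) (expSum B K) ⟩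
      expSum B K + (expSum B n - expSum B K)   ≤⟨ +-monoʳ-≤ (expSum B K) (expSum-squeeze ℕ.≤-refl K≤n) ⟩
      D                                        ∎

  expTerm-vanishes : ∀ {ε} → 0ℚ < ε →
    ∃ λ N → K ℕ.≤ N × (∀ n → N ℕ.≤ n → expTerm B n + expTerm B n ≤ ε)
  expTerm-vanishes {ε} 0<ε = N , ℕ.≤-trans (ℕ.n≤1+n K) (ℕ.s≤s (ℕ.m≤m⊔n K M)) , small
    where
    open ≤-Reasoning
    t C : ℚ
    t = expTerm B K
    C = t * B + t * B
    M N : ℕ
    M = proj₁ (eventually-small C 0<ε)
    N = suc (K ℕ.⊔ M)
    halved : ∀ n → K ℕ.≤ n → expTerm B (suc n) ≤ expTerm B n
    halved n K≤n = ≤-trans (p≤p+q (0≤expTerm (suc n))) (expTerm-halves n K≤n)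
    small : ∀ n → N ℕ.≤ n → expTerm B n + expTerm B n ≤ ε
    small (suc n) (ℕ.s≤s le) = begin
      expTerm B (suc n) + expTerm B (suc n)    ≤⟨ +-mono-≤ bound bound ⟩
      t * (B * recip M) + t * (B * recip M)    ≡⟨ solve 3 (λ t b r → t :* (b :* r) :+ t :* (b :* r) := (t :* b :+ t :* b) :* r) refl t B (recip M) ⟩
      C * recip M                              ≤⟨ proj₂ (eventually-small C 0<ε) ⟩
      ε                                        ∎
      where
      bound : expTerm B (suc n) ≤ t * (B * recip M)
      bound = *-mono (0≤expTerm K) (*-nonNeg 0≤B (0≤recip n))
        (decreasing {expTerm B} halved ℕ.≤-refl (ℕ.m⊔n≤o⇒m≤o K M le))
        (*-monoˡ 0≤B (recip-anti (ℕ.m⊔n≤o⇒n≤o K M le)))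

-- eˣ = ∑ xᵏ/k!.  Both the argument and the number of terms of the power series vary with n.
expℝ : ℝ → ℝ
expℝ (mkℝ a ca) = mkℝ (λ n → expSum (a n) n) (build (cauchy-bounded ca))
  where
  build : (∃ λ B → 0ℚ ≤ B × (∀ n → ∣ a n ∣ ≤ B)) → Cauchy (λ n → expSum (a n) n)
  build (B , 0≤B , ∣a∣≤B) = cauchy-intro (λ n → expSum (a n) n) (1ℚ + D) close
    where
    D : ℚ
    D = proj₁ (expSum-bounded 0≤B)
    close : ∀ ε → 0ℚ < ε → ∃ λ N → ∀ m n → N ℕ.≤ n → n ℕ.≤ m →
            ∣ expSum (a m) m - expSum (a n) n ∣ ≤ (1ℚ + D) * ε
    close ε 0<ε with ca ε 0<ε | expTerm-vanishes 0≤B 0<ε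
    ... | M , hM | N , K≤N , small = M ℕ.⊔ N , λ m n le n≤m →
      let M≤n = ℕ.m⊔n≤o⇒m≤o M N le ; N≤n = ℕ.m⊔n≤o⇒n≤o M N le in begin
      ∣ expSum (a m) m - expSum (a n) n ∣    ≤⟨ triangle (expSum (a m) m) (expSum (a m) n) (expSum (a n) n) ⟩
      ∣ expSum (a m) m - expSum (a m) n ∣ + ∣ expSum (a m) n - expSum (a n) n ∣
        ≤⟨ +-mono-≤
             (≤-trans (expSum-tail 0≤B (∣a∣≤B m) n≤m)
               (≤-trans (expSum-squeeze 0≤B (ℕ.≤-trans K≤N N≤n) n≤m) (small n N≤n)))
             (≤-trans (expSum-lipschitz 0≤B (∣a∣≤B m) (∣a∣≤B n) n)
               (*-mono (<⇒≤ 0<ε) (0≤expSum 0≤B n)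
                 (hM m n (ℕ.≤-trans M≤n n≤m) M≤n) (proj₂ (expSum-bounded 0≤B) n))) ⟩
      ε + ε * D                              ≡⟨ cong₂ _+_ (sym (*-identityˡ ε)) (*-comm ε D) ⟩
      1ℚ * ε + D * ε                         ≡⟨ *-distribʳ-+ ε 1ℚ D ⟨
      (1ℚ + D) * ε                           ∎
      where open ≤-Reasoning

harmonic : ℕ → ℚ
harmonic zero    = 0ℚ
harmonic (suc n) = harmonic n + recip n

-- With N = n + 1, this is the sum of 1/k over N < k ≤ r N, the right Riemann
-- sum of ∫₁ʳ dx/x for the mesh 1/N.
logSum : ℕ → ℕ → ℚ
logSum r n = harmonic (r ℕ.* suc n) - harmonic (suc n)

harmonic-lower : ∀ m j k → j ℕ.+ m ℕ.≤ suc k →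
  harmonic m + ι j * recip k ≤ harmonic (j ℕ.+ m)
harmonic-lower m zero    k _  = ≤-reflexive
  (trans (cong (harmonic m +_) (trans (cong (_* recip k) ι-0) (*-zeroˡ (recip k)))) (+-identityʳ (harmonic m)))
harmonic-lower m (suc j) k (ℕ.s≤s le) = begin
  harmonic m + ι (suc j) * recip k                 ≡⟨ cong (λ z → harmonic m + z * recip k) (ι-suc j) ⟩
  harmonic m + (1ℚ + ι j) * recip k                ≡⟨ cong (harmonic m +_) (*-distribʳ-+ (recip k) 1ℚ (ι j)) ⟩
  harmonic m + (1ℚ * recip k + ι j * recip k)      ≡⟨ cong (λ z → harmonic m + (z + ι j * recip k)) (*-identityˡ (recip k)) ⟩
  harmonic m + (recip k + ι j * recip k)           ≡⟨ solve 3 (λ h r i → h :+ (r :+ i) := (h :+ i) :+ r) refl (harmonic m) (recip k) (ι j * recip k) ⟩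
  harmonic m + ι j * recip k + recip k             ≤⟨ +-mono-≤ (harmonic-lower m j k (ℕ.m≤n⇒m≤1+n le)) (recip-anti le) ⟩
  harmonic (j ℕ.+ m) + recip (j ℕ.+ m)             ∎
  where open ≤-Reasoning

harmonic-upper : ∀ m j k → k ℕ.≤ m →
  harmonic (j ℕ.+ m) ≤ harmonic m + ι j * recip k
harmonic-upper m zero    k _  = ≤-reflexive
  (sym (trans (cong (harmonic m +_) (trans (cong (_* recip k) ι-0) (*-zeroˡ (recip k)))) (+-identityʳ (harmonic m))))
harmonic-upper m (suc j) k le = begin
  harmonic (j ℕ.+ m) + recip (j ℕ.+ m)             ≤⟨ +-mono-≤ (harmonic-upper m j k le) (recip-anti (ℕ.≤-trans le (ℕ.m≤n+m m j))) ⟩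
  harmonic m + ι j * recip k + recip k             ≡⟨ solve 3 (λ h r i → h :+ (r :+ i) := (h :+ i) :+ r) refl (harmonic m) (recip k) (ι j * recip k) ⟨
  harmonic m + (recip k + ι j * recip k)           ≡⟨ cong (λ z → harmonic m + (z + ι j * recip k)) (*-identityˡ (recip k)) ⟨
  harmonic m + (1ℚ * recip k + ι j * recip k)      ≡⟨ cong (harmonic m +_) (*-distribʳ-+ (recip k) 1ℚ (ι j)) ⟨
  harmonic m + (1ℚ + ι j) * recip k                ≡⟨ cong (λ z → harmonic m + z * recip k) (ι-suc j) ⟨
  harmonic m + ι (suc j) * recip k                 ∎
  where open ≤-Reasoning

ι-*-recip : ∀ s n → ι (suc s) * recip (n ℕ.+ s ℕ.* suc n) ≡ recip n
ι-*-recip s n = begin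
  ι (suc s) * recip k                              ≡⟨ *-identityʳ (ι (suc s) * recip k) ⟨
  ι (suc s) * recip k * 1ℚ                         ≡⟨ cong (ι (suc s) * recip k *_) (ι-recip n) ⟨
  ι (suc s) * recip k * (ι (suc n) * recip n)      ≡⟨ solve 4 (λ a b c d → a :* b :* (c :* d) := (a :* c) :* b :* d) refl (ι (suc s)) (recip k) (ι (suc n)) (recip n) ⟩
  ι (suc s) * ι (suc n) * recip k * recip n        ≡⟨ cong (λ z → z * recip k * recip n) (ι-* (suc s) (suc n)) ⟨
  ι (suc k) * recip k * recip n                    ≡⟨ cong (_* recip n) (ι-recip k) ⟩
  1ℚ * recip n                                     ≡⟨ *-identityˡ (recip n) ⟩
  recip n                                          ∎
  where
  open ≡-Reasoning
  k = n ℕ.+ s ℕ.* suc n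

module _ (s : ℕ) where

  private
    r : ℕ
    r = suc s

  logSum-increasing : ∀ n → logSum r n ≤ logSum r (suc n)
  logSum-increasing n = begin
    h - (g + recip n)                        ≡⟨ solve 4 (λ h g a b → h :- (g :+ a) := (h :+ b) :- (g :+ a :+ b)) refl h g (recip n) (recip (suc n)) ⟩
    h + recip (suc n) - (g + recip n + recip (suc n))  ≤⟨ +-monoˡ-≤ (- (g + recip n + recip (suc n))) key ⟩
    harmonic (r ℕ.* suc (suc n)) - (g + recip n + recip (suc n)) ∎
    where
    open ≤-Reasoning
    h g : ℚ
    h = harmonic (r ℕ.* suc n)
    g = harmonic n
    key : h + recip (suc n) ≤ harmonic (r ℕ.* suc (suc n))
    key = subst₂ (λ p q → h + p ≤ harmonic q) (ι-*-recip s (suc n)) (sym (ℕ.*-suc r (suc n)))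
      (harmonic-lower (r ℕ.* suc n) r (suc n ℕ.+ s ℕ.* suc (suc n))
        (ℕ.≤-reflexive (sym (ℕ.*-suc r (suc n)))))

  logSum-decreasing : ∀ n → logSum r (suc n) + recip (suc n) ≤ logSum r n + recip n
  logSum-decreasing n = begin
    h′ - (g + recip (suc n)) + recip (suc n)   ≡⟨ solve 3 (λ h g a → h :- (g :+ a) :+ a := h :- g) refl h′ g (recip (suc n)) ⟩
    h′ - g                                     ≤⟨ +-monoˡ-≤ (- g) key ⟩
    h + recip n - g                            ≡⟨ solve 3 (λ h g a → h :+ a :- g := h :- g :+ a) refl h g (recip n) ⟩
    h - g + recip n                            ∎
    where
    open ≤-Reasoning
    h h′ g : ℚ
    h  = harmonic (r ℕ.* suc n)
    h′ = harmonic (r ℕ.* suc (suc n))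
    g  = harmonic (suc n)
    key : h′ ≤ h + recip n
    key = subst₂ (λ p q → harmonic q ≤ h + p) (ι-*-recip s n) (sym (ℕ.*-suc r (suc n)))
      (harmonic-upper (r ℕ.* suc n) r (n ℕ.+ s ℕ.* suc n) (ℕ.n≤1+n _))

  logSum-cauchy : Cauchy (logSum r)
  logSum-cauchy = cauchy-intro (logSum r) 1ℚ λ ε 0<ε →
    let N , small = eventually-small 1ℚ 0<ε in N , λ m n N≤n n≤m → begin
    ∣ logSum r m - logSum r n ∣    ≡⟨ dist-of-≤ (increasing {logSum r} (λ k _ → logSum-increasing k) ℕ.z≤n n≤m) ⟩
    logSum r m - logSum r n        ≤⟨ squeeze {logSum r} {recip} (λ k _ → logSum-decreasing k) 0≤recip ℕ.z≤n n≤m ⟩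
    recip n                        ≤⟨ recip-anti N≤n ⟩
    recip N                        ≡⟨ *-identityˡ (recip N) ⟨
    1ℚ * recip N                   ≤⟨ small ⟩
    ε                              ≡⟨ *-identityˡ ε ⟨
    1ℚ * ε                         ∎
    where open ≤-Reasoning

-- log r = ∫₁ʳ dx/x, as the limit of the sums logSum r.
logℝ : (r : ℕ) → .{{ℕ.NonZero r}} → ℝ
logℝ (suc s) = mkℝ (logSum (suc s)) (logSum-cauchy s)

∑ : ∀ {n} → (Fin n → ℝ) → ℝ
∑ {zero}  g = fromℕℝ 0
∑ {suc n} g = g Fin.zero +ℝ ∑ (λ i → g (Fin.suc i))

-- The index k = 1, …, r is suc (toℕ i) for i : Fin r.
f : ℕ → (r : ℕ) → .{{ℕ.NonZero r}} → ℝ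
f zero    r = logℝ r
f (suc d) r = fromℚ (ℤ.+ 1 / r) *ℝ ∑ {r} (λ i → f d (suc (toℕ i)))

indices : ∀ n m → List (Vec (Fin n) m)
indices n zero    = [] ∷ []
indices n (suc m) = List.cartesianProductWith _∷_ (List.allFin n) (indices n m)

∏[_]^_ : ∀ n m → (Vec (Fin n) m → ℝ) → ℝ
(∏[ n ]^ m) g = List.foldr (λ i p → g i *ℝ p) (fromℕℝ 1) (indices n m)

-- 0-1 arrays on [n]^m, with true for 1 and false for 0.
Array : ℕ → ℕ → Set
Array n zero    = Bool
Array n (suc m) = Vec (Array n m) n

entry : ∀ {n m} → Array n m → Vec (Fin n) m → Bool
entry {m = zero}  P []      = P
entry {m = suc m} P (i ∷ v) = entry (Vec.lookup P i) v

-- v lists the fixed indices, in order; the index t runs over position j.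
line : ∀ {n m} → Array n (suc m) → Fin (suc m) → Vec (Fin n) m → Vec Bool n
line P j v = Vec.tabulate (λ t → entry P (Vec.insertAt v j t))

ones : ∀ {n} → Vec Bool n → ℕ
ones = Vec.count (Bool._≟ true)

IsPermutation : ∀ {n} d → Array n (suc d) → Set
IsPermutation {n} d P = ∀ (j : Fin (suc d)) (v : Vec (Fin n) d) → ones (line P j v) ≡ 1

Supports : ∀ {n m} → Array n m → Array n m → Set
Supports {n} {m} M₁ M₂ = ∀ (v : Vec (Fin n) m) → entry M₂ v ≡ true → entry M₁ v ≡ true

lastLineOnes : ∀ {n} d → Array n (suc d) → Vec (Fin n) d → ℕ
lastLineOnes d A v = ones (line A (fromℕ d) v)

allVecs : ∀ {X : Set} → List X → ∀ n → List (Vec X n)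
allVecs xs zero    = [] ∷ []
allVecs xs (suc n) = List.cartesianProductWith _∷_ xs (allVecs xs n)

-- Every array occurs exactly once.
allArrays : ∀ n m → List (Array n m)
allArrays n zero    = false ∷ true ∷ []
allArrays n (suc m) = allVecs (allArrays n m) n

∀Vec? : ∀ {n m} {Q : Vec (Fin n) m → Set} → Decidable Q → Dec (∀ v → Q v)
∀Vec? {m = zero}  Q? = map′ (λ { q [] → q }) (λ q → q []) (Q? [])
∀Vec? {m = suc m} Q? = map′ (λ { q (i ∷ v) → q i v }) (λ q i v → q (i ∷ v))
  (Fin.all? (λ i → ∀Vec? (λ v → Q? (i ∷ v))))

isPermutation? : ∀ {n} d (P : Array n (suc d)) → Dec (IsPermutation d P)
isPermutation? d P = Fin.all? (λ j → ∀Vec? (λ v → ones (line P j v) ℕ.≟ 1))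

supports? : ∀ {n m} (M₁ M₂ : Array n m) → Dec (Supports M₁ M₂)
supports? M₁ M₂ = ∀Vec? (λ v → (entry M₂ v Bool.≟ true) →-dec (entry M₁ v Bool.≟ true))

Per : ∀ {n} d → Array n (suc d) → ℕ
Per {n} d A = List.length
  (List.filter (λ P → isPermutation? d P ×-dec supports? A P) (allArrays n (suc d)))

{-# OPTIONS --safe #-}

-- Fix an order of [n] for each of the first d coordinates and reveal a permutation P
-- supported by A lexicographically, one line P(v, ∗) at a time.  Let N_v be the number of t
-- with A(v, t) = 1 for which no earlier cell on a line through (v, t) is a one of P.  At most
-- N_v values are possible at v, so ∑_P ∏_v 1/N_v ≤ 1 for every choice of the orders.  For
-- fixed P and random orders the expectation of log N_v is f(d, r_v), because each of the d
-- coordinates in turn replaces the number of remaining values by a uniform element of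
-- 1, …, that number.  By convexity the expectation of ∏_v 1/N_v is at least
-- exp(−∑_v f(d, r_v)); summing over P gives the bound.
--
-- The convexity argument is carried out over ℚ, with eˣ replaced by (1 + x/j)ʲ and log by the
-- approximations logSum, at the cost of an error term ∣V∣ / (n₀ + 1), where V = [n]ᵈ.
module Submission where

open import Defs
open import Data.Nat.Base using (ℕ; suc; _≤_; >-nonZero)
open import Data.Fin.Base using (Fin)
open import Data.Vec.Base using (Vec)

open import Algebra.Bundles using (CommutativeRing)
open import Algebra.Core using (Op₂)
open import Algebra.Structures using (IsCommutativeMonoid)
open import Data.Bool.Base using (Bool; true; false; if_then_else_; _∧_; _∨_; not)
open import Data.Bool.ListAction using (any)
import Data.Bool.Properties as Bool
open import Data.Fin.Base as Fin using (fromℕ; toℕ)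
import Data.Fin.Properties as Fin
import Data.Integer.Base as ℤ
open import Data.List.Base as List using (List; []; _∷_; _++_; map; concatMap; cartesianProductWith; length; replicate; filter; allFin)
open import Data.List.Membership.Propositional using (_∈_; find)
open import Data.List.Membership.Propositional.Properties
  using (∈-map⁻; ∈-concatMap⁻; ∈-filter⁻; ∈-allFin; ∈-cartesianProductWith⁺; ∈-cartesianProductWith⁻)
import Data.List.Properties as List
open import Data.List.Relation.Binary.Permutation.Propositional as ↭ using (_↭_; ↭-sym; ↭⇒↭ₛ)
import Data.List.Relation.Binary.Permutation.Propositional.Properties as ↭
import Data.List.Relation.Binary.Permutation.Setoid.Properties as ↭ₛ
open import Data.List.Relation.Unary.All as All using (All; []; _∷_)
import Data.List.Relation.Unary.All.Properties as All
open import Data.List.Relation.Unary.AllPairs as AllPairs using (AllPairs; []; _∷_)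
import Data.List.Relation.Unary.AllPairs.Properties as AllPairs
open import Data.List.Relation.Unary.Any using (here; there)
open import Data.List.Relation.Unary.Unique.Propositional using (Unique)
import Data.List.Relation.Unary.Unique.Propositional.Properties as Unique
open import Data.Maybe.Base using (Maybe; just; nothing; maybe)
open import Data.Nat.Base as ℕ using (zero; _!)
import Data.Nat.Properties as ℕ
open import Data.Product.Base using (∃; _×_; _,_; proj₁; proj₂)
open import Data.Rational.Base as ℚ using (ℚ; 0ℚ; 1ℚ; _+_; _*_; _-_; -_)
  renaming (_≤_ to _≤ℚ_; _<_ to _<ℚ_)
import Data.Rational.Properties as ℚ
open import Data.Rational.Solver using (module +-*-Solver)
open import Data.Sum.Base using (_⊎_; inj₁; inj₂)
open import Data.Vec.Base as Vec using ([]; _∷_)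
import Data.Vec.Properties as Vec
open import Function.Base using (_∘_; id)
open import Relation.Binary.Definitions using (DecidableEquality)
open import Relation.Binary.PropositionalEquality
  using (_≡_; _≢_; refl; setoid; sym; trans; cong; cong₂; subst; module ≡-Reasoning)
open import Relation.Nullary.Decidable using (dec-true; dec-false; _×-dec_)
open import Relation.Nullary.Decidable.Core using (Dec; yes; no; does)
open import Relation.Nullary.Negation.Core using (¬_; contradiction)

open import Algebra.Properties.CommutativeSemiring.Exp
  (CommutativeRing.commutativeSemiring ℚ.+-*-commutativeRing) using (_^_; ^-distrib-*; ^-assocʳ)
open +-*-Solver using (solve; _:=_; _:+_; _:*_; _:-_; :-_; con)

-- The relation `_≤ℝ_` compares sequences index by index up to ε, and sums and products of reals act
-- termwise. So at an index m the right side is a rational product of `expSum (fApprox m d r) m`,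
-- and the rationals `fApprox m d q` obey the recursion of `f` exactly. Averaging over the orders is
-- therefore free of error; the only error lies in comparing an integer with its approximate
-- logarithm. Exact J-th roots would leave ℚ. The J-th root of N_v is replaced by the upper bound 1
-- + (log N_v + 1/(n₀ + 1))/J, whose J-th power is at least N_v. One J must serve all v, because the
-- powers are multiplied together before the tangent argument is applied. The error in each mean is
-- 1/((n₀ + 1)J), and raising to the power J turns it into 1/(n₀ + 1), whatever J is. Two indices
-- are kept apart: n₀ fixes the mesh of the Riemann sums and depends on the target ε, while m is the
-- index of the sequences and runs to infinity. As `logSum r` increases, the estimate made at n₀
-- persists at every m ≥ n₀.

-- Finite sums and products over lists

module BigOperator {C : Set} {_∙_ : Op₂ C} {ε : C}
  (isCM : IsCommutativeMonoid _≡_ _∙_ ε) where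

  open IsCommutativeMonoid isCM using (assoc; comm; identityˡ; identityʳ)

  over : ∀ {A : Set} → List A → (A → C) → C
  over xs g = List.foldr (λ x acc → g x ∙ acc) ε xs

  module _ {A : Set} where

    over-cong : ∀ (xs : List A) {g h : A → C} → (∀ x → x ∈ xs → g x ≡ h x) →
      over xs g ≡ over xs h
    over-cong []       _ = refl
    over-cong (x ∷ xs) e =
      cong₂ _∙_ (e x (here refl)) (over-cong xs (λ y y∈ → e y (there y∈)))

    over-++ : ∀ (xs ys : List A) g → over (xs ++ ys) g ≡ over xs g ∙ over ys g
    over-++ []       ys g = sym (identityˡ _)
    over-++ (x ∷ xs) ys g =
      trans (cong (g x ∙_) (over-++ xs ys g)) (sym (assoc _ _ _))

    over-ε : ∀ (xs : List A) → over xs (λ _ → ε) ≡ ε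
    over-ε []       = refl
    over-ε (x ∷ xs) = trans (identityˡ _) (over-ε xs)

    interchange : ∀ a b c d → (a ∙ b) ∙ (c ∙ d) ≡ (a ∙ c) ∙ (b ∙ d)
    interchange a b c d = begin
      (a ∙ b) ∙ (c ∙ d)  ≡⟨ assoc a b _ ⟩
      a ∙ (b ∙ (c ∙ d))  ≡⟨ cong (a ∙_) (sym (assoc b c d)) ⟩
      a ∙ ((b ∙ c) ∙ d)  ≡⟨ cong (λ z → a ∙ (z ∙ d)) (comm b c) ⟩
      a ∙ ((c ∙ b) ∙ d)  ≡⟨ cong (a ∙_) (assoc c b d) ⟩
      a ∙ (c ∙ (b ∙ d))  ≡⟨ sym (assoc a c _) ⟩
      (a ∙ c) ∙ (b ∙ d)  ∎
      where open ≡-Reasoning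

    over-∙ : ∀ (xs : List A) g h → over xs (λ x → g x ∙ h x) ≡ over xs g ∙ over xs h
    over-∙ []       g h = sym (identityˡ ε)
    over-∙ (x ∷ xs) g h =
      trans (cong ((g x ∙ h x) ∙_) (over-∙ xs g h)) (interchange _ _ _ _)

    over-↭ : ∀ {xs ys : List A} → xs ↭ ys → ∀ g → over xs g ≡ over ys g
    over-↭ ↭.refl         g = refl
    over-↭ (↭.prep x p)   g = cong (g x ∙_) (over-↭ p g)
    over-↭ (↭.swap x y p) g = begin
      g x ∙ (g y ∙ _)  ≡⟨ sym (assoc _ _ _) ⟩
      (g x ∙ g y) ∙ _  ≡⟨ cong₂ _∙_ (comm _ _) (over-↭ p g) ⟩
      (g y ∙ g x) ∙ _  ≡⟨ assoc _ _ _ ⟩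
      g y ∙ (g x ∙ _)  ∎
      where open ≡-Reasoning
    over-↭ (↭.trans p q)  g = trans (over-↭ p g) (over-↭ q g)

  module _ {A B : Set} where

    over-map : ∀ (φ : A → B) xs g → over (map φ xs) g ≡ over xs (g ∘ φ)
    over-map φ []       g = refl
    over-map φ (x ∷ xs) g = cong (g (φ x) ∙_) (over-map φ xs g)

    over-concatMap : ∀ (φ : A → List B) xs g →
      over (concatMap φ xs) g ≡ over xs (λ x → over (φ x) g)
    over-concatMap φ []       g = refl
    over-concatMap φ (x ∷ xs) g =
      trans (over-++ (φ x) _ g) (cong (over (φ x) g ∙_) (over-concatMap φ xs g))

    over-swap : ∀ (xs : List A) (ys : List B) (g : A → B → C) →
      over xs (λ x → over ys (g x)) ≡ over ys (λ y → over xs (λ x → g x y))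
    over-swap []       ys g = sym (over-ε ys)
    over-swap (x ∷ xs) ys g =
      trans (cong (over ys (g x) ∙_) (over-swap xs ys g)) (sym (over-∙ ys _ _))

  over-cartesianProductWith : ∀ {A B D : Set} (φ : A → B → D) xs ys g →
    over (cartesianProductWith φ xs ys) g ≡ over xs (λ x → over ys (λ y → g (φ x y)))
  over-cartesianProductWith φ []       ys g = refl
  over-cartesianProductWith φ (x ∷ xs) ys g =
    trans (over-++ (map (φ x) ys) _ g)
      (cong₂ _∙_ (over-map (φ x) ys g) (over-cartesianProductWith φ xs ys g))

module Σ = BigOperator ℚ.+-0-isCommutativeMonoid
module Π = BigOperator ℚ.*-1-isCommutativeMonoid
module # = BigOperator ℕ.+-0-isCommutativeMonoid

-- Order properties of rational sums, products and powers

0≤1ℚ : 0ℚ ≤ℚ 1ℚ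
0≤1ℚ = ℚ.nonNegative⁻¹ 1ℚ

p≤q⇒0≤q-p : ∀ {p q} → p ≤ℚ q → 0ℚ ≤ℚ q - p
p≤q⇒0≤q-p {p} {q} p≤q = subst (_≤ℚ q - p) (ℚ.+-inverseʳ p) (ℚ.+-monoˡ-≤ (- p) p≤q)

0≤p² : ∀ p → 0ℚ ≤ℚ p * p
0≤p² p with ℚ.≤-total 0ℚ p
... | inj₁ 0≤p = *-nonNeg 0≤p 0≤p
... | inj₂ p≤0 = subst (0ℚ ≤ℚ_) (solve 1 (λ x → (:- x) :* (:- x) := x :* x) refl p)
                   (*-nonNeg 0≤-p 0≤-p)
  where
  0≤-p : 0ℚ ≤ℚ - p
  0≤-p = ℚ.neg-antimono-≤ p≤0

module _ {A : Set} where

  Σ-mono : ∀ (xs : List A) {g h} → (∀ x → x ∈ xs → g x ≤ℚ h x) → Σ.over xs g ≤ℚ Σ.over xs h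
  Σ-mono []       _  = ℚ.≤-refl
  Σ-mono (x ∷ xs) le =
    ℚ.+-mono-≤ (le x (here refl)) (Σ-mono xs (λ y y∈ → le y (there y∈)))

  Σ-nonNeg : ∀ (xs : List A) {g} → (∀ x → x ∈ xs → 0ℚ ≤ℚ g x) → 0ℚ ≤ℚ Σ.over xs g
  Σ-nonNeg xs {g} 0≤g = subst (_≤ℚ Σ.over xs g) (Σ.over-ε xs) (Σ-mono xs 0≤g)

  *-distribˡ-Σ : ∀ c (xs : List A) g → c * Σ.over xs g ≡ Σ.over xs (λ x → c * g x)
  *-distribˡ-Σ c []       g = ℚ.*-zeroʳ c
  *-distribˡ-Σ c (x ∷ xs) g =
    trans (ℚ.*-distribˡ-+ c (g x) _) (cong (c * g x +_) (*-distribˡ-Σ c xs g))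

  *-distribʳ-Σ : ∀ c (xs : List A) g → Σ.over xs g * c ≡ Σ.over xs (λ x → g x * c)
  *-distribʳ-Σ c xs g = trans (ℚ.*-comm _ c)
    (trans (*-distribˡ-Σ c xs g) (Σ.over-cong xs (λ x _ → ℚ.*-comm c (g x))))

  Σ-const : ∀ (xs : List A) c → Σ.over xs (λ _ → c) ≡ ι (length xs) * c
  Σ-const []       c = sym (trans (cong (_* c) ι-0) (ℚ.*-zeroˡ c))
  Σ-const (x ∷ xs) c = begin
    c + Σ.over xs (λ _ → c)     ≡⟨ cong₂ _+_ (sym (ℚ.*-identityˡ c)) (Σ-const xs c) ⟩
    1ℚ * c + ι (length xs) * c  ≡⟨ ℚ.*-distribʳ-+ c 1ℚ (ι (length xs)) ⟨
    (1ℚ + ι (length xs)) * c    ≡⟨ cong (_* c) (ι-suc (length xs)) ⟨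
    ι (suc (length xs)) * c     ∎
    where open ≡-Reasoning

  Π-nonNeg : ∀ (xs : List A) {g} → (∀ x → x ∈ xs → 0ℚ ≤ℚ g x) → 0ℚ ≤ℚ Π.over xs g
  Π-nonNeg []       _   = 0≤1ℚ
  Π-nonNeg (x ∷ xs) 0≤g =
    *-nonNeg (0≤g x (here refl)) (Π-nonNeg xs (λ y y∈ → 0≤g y (there y∈)))

  Π-mono : ∀ (xs : List A) {g h} → (∀ x → x ∈ xs → 0ℚ ≤ℚ g x) →
    (∀ x → x ∈ xs → g x ≤ℚ h x) → Π.over xs g ≤ℚ Π.over xs h
  Π-mono []       _   _  = ℚ.≤-refl
  Π-mono (x ∷ xs) 0≤g le = *-mono
    (ℚ.≤-trans (0≤g x (here refl)) (le x (here refl)))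
    (Π-nonNeg xs (λ y y∈ → 0≤g y (there y∈)))
    (le x (here refl))
    (Π-mono xs (λ y y∈ → 0≤g y (there y∈)) (λ y y∈ → le y (there y∈)))

1^n≡1 : ∀ n → 1ℚ ^ n ≡ 1ℚ
1^n≡1 zero    = refl
1^n≡1 (suc n) = trans (ℚ.*-identityˡ _) (1^n≡1 n)

^-nonNeg : ∀ {p} → 0ℚ ≤ℚ p → ∀ n → 0ℚ ≤ℚ p ^ n
^-nonNeg 0≤p zero    = 0≤1ℚ
^-nonNeg 0≤p (suc n) = *-nonNeg 0≤p (^-nonNeg 0≤p n)

^-mono : ∀ {p q} → 0ℚ ≤ℚ p → p ≤ℚ q → ∀ n → p ^ n ≤ℚ q ^ n
^-mono 0≤p p≤q zero    = ℚ.≤-refl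
^-mono 0≤p p≤q (suc n) =
  *-mono (ℚ.≤-trans 0≤p p≤q) (^-nonNeg 0≤p n) p≤q (^-mono 0≤p p≤q n)

Π-^ : ∀ {A : Set} (xs : List A) g n → Π.over xs (λ x → g x ^ n) ≡ Π.over xs g ^ n
Π-^ []       g n = sym (1^n≡1 n)
Π-^ (x ∷ xs) g n = trans (cong (g x ^ n *_) (Π-^ xs g n)) (sym (^-distrib-* (g x) _ n))

-- The inequality of arithmetic and geometric means

bernoulli : ∀ {a b} → 0ℚ ≤ℚ a → 0ℚ ≤ℚ b → ∀ k →
  (ι (suc k) * b - ι k * a) * a ^ k ≤ℚ b ^ suc k
bernoulli {a} {b} _ _ zero = ℚ.≤-reflexive (begin
  (ι 1 * b - ι 0 * a) * 1ℚ         ≡⟨ cong₂ (λ x y → (x * b - y * a) * 1ℚ) (trans (ι-suc 0) (cong (1ℚ +_) ι-0)) ι-0 ⟩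
  ((1ℚ + 0ℚ) * b - 0ℚ * a) * 1ℚ    ≡⟨ solve 2 (λ a b → ((con 1ℚ :+ con 0ℚ) :* b :- con 0ℚ :* a) :* con 1ℚ := b :* con 1ℚ) refl a b ⟩
  b * 1ℚ                           ∎)
  where open ≡-Reasoning
bernoulli {a} {b} 0≤a 0≤b (suc k) = begin
  (ι (suc (suc k)) * b - ι (suc k) * a) * (a * A)
    -- The added term (k + 1)(b - a)²aᵏ is exactly the difference between `b` times the bound for
    -- `k` and the bound for `suc k`.
    ≤⟨ p≤p+q (*-nonNeg (*-nonNeg (0≤ι (suc k)) (0≤p² (b - a))) (^-nonNeg 0≤a k)) ⟩
  (ι (suc (suc k)) * b - ι (suc k) * a) * (a * A) + ι (suc k) * ((b - a) * (b - a)) * A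
    ≡⟨ cong₂ (λ x y → (x * b - y * a) * (a * A) + y * ((b - a) * (b - a)) * A)
         (trans (ι-suc (suc k)) (cong (1ℚ +_) (ι-suc k))) (ι-suc k) ⟩
  ((1ℚ + (1ℚ + i)) * b - (1ℚ + i) * a) * (a * A) + (1ℚ + i) * ((b - a) * (b - a)) * A
    ≡⟨ solve 4 (λ a b i A → ((con 1ℚ :+ (con 1ℚ :+ i)) :* b :- (con 1ℚ :+ i) :* a) :* (a :* A)
                              :+ (con 1ℚ :+ i) :* ((b :- a) :* (b :- a)) :* A
                            := b :* (((con 1ℚ :+ i) :* b :- i :* a) :* A)) refl a b i A ⟩
  b * (((1ℚ + i) * b - i * a) * A)
    ≡⟨ cong (λ x → b * ((x * b - i * a) * A)) (ι-suc k) ⟨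
  b * ((ι (suc k) * b - i * a) * A)
    ≤⟨ *-monoˡ 0≤b (bernoulli 0≤a 0≤b k) ⟩
  b * b ^ suc k ∎
  where
  open ℚ.≤-Reasoning
  i = ι k
  A = a ^ k

-- Since `recip k` is 1/(k + 1), the factor `recip (ℕ.pred k)` is 1/k for k ≥ 1. At k = 0 it is 1,
-- and both sides vanish.
Σ-mean : ∀ {A : Set} (xs : List A) g →
  Σ.over xs g ≡ ι (length xs) * (Σ.over xs g * recip (ℕ.pred (length xs)))
Σ-mean []       g = sym (trans (cong (_* (0ℚ * recip 0)) ι-0) (ℚ.*-zeroˡ (0ℚ * recip 0)))
Σ-mean (x ∷ xs) g = begin
  s                                        ≡⟨ ℚ.*-identityʳ s ⟨
  s * 1ℚ                                   ≡⟨ cong (s *_) (ι-recip (length xs)) ⟨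
  s * (ι (suc (length xs)) * r)            ≡⟨ solve 3 (λ s i r → s :* (i :* r) := i :* (s :* r)) refl s (ι (suc (length xs))) r ⟩
  ι (suc (length xs)) * (s * r)            ∎
  where
  open ≡-Reasoning
  s r : ℚ
  s = Σ.over (x ∷ xs) g
  r = recip (length xs)

-- With `m` the mean of the tail, the hypothesis bounds the head by (k + 1)a - km, and `bernoulli`
-- at `m` absorbs mᵏ. Allowing any upper bound `a` of the mean avoids division.
amgm : ∀ {A : Set} (xs : List A) {g a} → (∀ x → x ∈ xs → 0ℚ ≤ℚ g x) → 0ℚ ≤ℚ a →
  Σ.over xs g ≤ℚ ι (length xs) * a → Π.over xs g ≤ℚ a ^ length xs
amgm []           _ _ _ = ℚ.≤-refl
amgm (x ∷ xs) {g} {a} 0≤g 0≤a le = begin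
  g x * Π.over xs g                              ≤⟨ *-monoˡ (0≤g x (here refl)) (amgm xs 0≤g′ 0≤m (ℚ.≤-reflexive mean)) ⟩
  g x * m ^ length xs                            ≤⟨ *-monoʳ (^-nonNeg 0≤m (length xs)) gx≤ ⟩
  (ι (suc (length xs)) * a - ι (length xs) * m) * m ^ length xs  ≤⟨ bernoulli 0≤m 0≤a (length xs) ⟩
  a ^ suc (length xs)                            ∎
  where
  open ℚ.≤-Reasoning
  0≤g′ : ∀ y → y ∈ xs → 0ℚ ≤ℚ g y
  0≤g′ y y∈ = 0≤g y (there y∈)
  m : ℚ
  m = Σ.over xs g * recip (ℕ.pred (length xs))
  0≤m : 0ℚ ≤ℚ m
  0≤m = *-nonNeg (Σ-nonNeg xs 0≤g′) (0≤recip _)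
  mean : Σ.over xs g ≡ ι (length xs) * m
  mean = Σ-mean xs g
  gx≤ : g x ≤ℚ ι (suc (length xs)) * a - ι (length xs) * m
  gx≤ = begin
    g x                                            ≡⟨ solve 2 (λ p q → p := p :+ q :- q) refl (g x) (Σ.over xs g) ⟩
    g x + Σ.over xs g - Σ.over xs g                ≤⟨ ℚ.+-monoˡ-≤ (- Σ.over xs g) le ⟩
    ι (suc (length xs)) * a - Σ.over xs g          ≡⟨ cong (λ z → ι (suc (length xs)) * a - z) mean ⟩
    ι (suc (length xs)) * a - ι (length xs) * m    ∎

-- Lower bounds for exp and upper bounds for integers in terms of their logarithms

ι-suc-* : ∀ k p → ι (suc k) * p ≡ p + ι k * p
ι-suc-* k p = trans (cong (_* p) (ι-suc k))
  (trans (ℚ.*-distribʳ-+ p 1ℚ (ι k)) (cong (_+ ι k * p) (ℚ.*-identityˡ p)))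

ι-suc-*-recip : ∀ k p → ι (suc k) * (p * recip k) ≡ p
ι-suc-*-recip k p = begin
  ι (suc k) * (p * recip k)  ≡⟨ solve 3 (λ i p r → i :* (p :* r) := p :* (i :* r)) refl (ι (suc k)) p (recip k) ⟩
  p * (ι (suc k) * recip k)  ≡⟨ cong (p *_) (ι-recip k) ⟩
  p * 1ℚ                     ≡⟨ ℚ.*-identityʳ p ⟩
  p                          ∎
  where open ≡-Reasoning

module _ {x u : ℚ} (0≤x : 0ℚ ≤ℚ x) (0≤u : 0ℚ ≤ℚ u) where

  -- These are the first two terms of the binomial expansion of (x + u)ᵏ⁺¹/(k + 1)!. In the
  -- induction, the dropped part is the one quadratic in `u`.
  expTerm-+ : ∀ k → expTerm x (suc k) + u * expTerm x k ≤ℚ expTerm (x + u) (suc k)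
  expTerm-+ zero = ℚ.≤-reflexive (begin
    1ℚ * (x * recip 0) + u * 1ℚ    ≡⟨ cong (λ r → 1ℚ * (x * r) + u * 1ℚ) recip-0 ⟩
    1ℚ * (x * 1ℚ) + u * 1ℚ         ≡⟨ solve 2 (λ x u → con 1ℚ :* (x :* con 1ℚ) :+ u :* con 1ℚ := con 1ℚ :* ((x :+ u) :* con 1ℚ)) refl x u ⟩
    1ℚ * ((x + u) * 1ℚ)            ≡⟨ cong (λ r → 1ℚ * ((x + u) * r)) recip-0 ⟨
    1ℚ * ((x + u) * recip 0)       ∎)
    where open ≡-Reasoning
  expTerm-+ (suc k) = begin
    e′ * (x * r′) + u * e′
      ≡⟨ cong (λ z → e′ * (x * r′) + u * z) (trans (sym (ℚ.*-identityʳ e′)) (cong (e′ *_) (sym (ι-recip (suc k))))) ⟩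
    e′ * (x * r′) + u * (e′ * (ι (suc (suc k)) * r′))
      ≡⟨ cong (λ z → e′ * (x * r′) + u * (e′ * (z * r′))) (ι-suc (suc k)) ⟩
    e′ * (x * r′) + u * (e′ * ((1ℚ + i) * r′))
      ≡⟨ solve 5 (λ x u e i r → e :* (x :* r) :+ u :* (e :* ((con 1ℚ :+ i) :* r))
                             := e :* ((x :+ u) :* r) :+ u :* (i :* e) :* r) refl x u e′ i r′ ⟩
    e′ * ((x + u) * r′) + u * (i * e′) * r′
      ≡⟨ cong (λ z → e′ * ((x + u) * r′) + u * z * r′) ie′≡ ⟩
    e′ * ((x + u) * r′) + u * (e * x) * r′
      ≤⟨ p≤p+q (*-nonNeg (*-nonNeg 0≤u (*-nonNeg (0≤expTerm 0≤x k) 0≤u)) (0≤recip (suc k))) ⟩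
    e′ * ((x + u) * r′) + u * (e * x) * r′ + u * (e * u) * r′
      ≡⟨ solve 5 (λ x u e f r → f :* ((x :+ u) :* r) :+ u :* (e :* x) :* r :+ u :* (e :* u) :* r
                             := (f :+ u :* e) :* ((x :+ u) :* r)) refl x u e e′ r′ ⟩
    (e′ + u * e) * ((x + u) * r′)
      ≤⟨ *-monoʳ (*-nonNeg (+-nonNeg 0≤x 0≤u) (0≤recip (suc k))) (expTerm-+ k) ⟩
    expTerm (x + u) (suc k) * ((x + u) * r′) ∎
    where
    open ℚ.≤-Reasoning
    e e′ r′ i : ℚ
    e  = expTerm x k
    e′ = expTerm x (suc k)
    r′ = recip (suc k)
    i  = ι (suc k)
    ie′≡ : i * e′ ≡ e * x
    ie′≡ = trans (cong (i *_) (sym (ℚ.*-assoc e x (recip k)))) (ι-suc-*-recip k (e * x))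

  expSum-+ : ∀ m → expSum x (suc m) + u * expSum x m ≤ℚ expSum (x + u) (suc m)
  expSum-+ zero    = ℚ.≤-reflexive (solve 1 (λ u → con 0ℚ :+ con 1ℚ :+ u :* con 0ℚ := con 0ℚ :+ con 1ℚ) refl u)
  expSum-+ (suc m) = begin
    s + t + u * (expSum x m + expTerm x m)
      ≡⟨ solve 5 (λ s t u a b → s :+ t :+ u :* (a :+ b) := (s :+ u :* a) :+ (t :+ u :* b)) refl s t u (expSum x m) (expTerm x m) ⟩
    (s + u * expSum x m) + (t + u * expTerm x m)
      ≤⟨ ℚ.+-mono-≤ (expSum-+ m) (expTerm-+ m) ⟩
    expSum (x + u) (suc (suc m)) ∎
    where
    open ℚ.≤-Reasoning
    s t : ℚ
    s = expSum x (suc m)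
    t = expTerm x (suc m)

-- A factor 1 + u is absorbed by moving the argument by `u`, at the price of one more term of the
-- series.
[1+u]^i≤expSum : ∀ {u} → 0ℚ ≤ℚ u → ∀ i → (1ℚ + u) ^ i ≤ℚ expSum (ι i * u) (suc i)
[1+u]^i≤expSum {u} 0≤u zero    = ℚ.≤-reflexive (sym (ℚ.+-identityˡ 1ℚ))
[1+u]^i≤expSum {u} 0≤u (suc i) = begin
  (1ℚ + u) * (1ℚ + u) ^ i                              ≤⟨ *-monoˡ (+-nonNeg 0≤1ℚ 0≤u) ([1+u]^i≤expSum 0≤u i) ⟩
  (1ℚ + u) * expSum x (suc i)                          ≡⟨ solve 2 (λ u s → (con 1ℚ :+ u) :* s := s :+ u :* s) refl u (expSum x (suc i)) ⟩
  expSum x (suc i) + u * expSum x (suc i)              ≤⟨ ℚ.+-monoˡ-≤ (u * expSum x (suc i)) (expSum-mono 0≤x (ℕ.n≤1+n (suc i))) ⟩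
  expSum x (suc (suc i)) + u * expSum x (suc i)        ≤⟨ expSum-+ 0≤x 0≤u (suc i) ⟩
  expSum (x + u) (suc (suc i))                         ≡⟨ cong (λ z → expSum z (suc (suc i))) (trans (ℚ.+-comm x u) (sym (ι-suc-* i u))) ⟩
  expSum (ι (suc i) * u) (suc (suc i))                 ∎
  where
  open ℚ.≤-Reasoning
  x : ℚ
  x = ι i * u
  0≤x : 0ℚ ≤ℚ x
  0≤x = *-nonNeg (0≤ι i) 0≤u

[1+x/j]^j≤expSum : ∀ {x} → 0ℚ ≤ℚ x → ∀ {j m} → suc (suc j) ≤ m →
  (1ℚ + x * recip j) ^ suc j ≤ℚ expSum x m
[1+x/j]^j≤expSum {x} 0≤x {j} {m} le = begin
  (1ℚ + x * recip j) ^ suc j                      ≤⟨ [1+u]^i≤expSum (*-nonNeg 0≤x (0≤recip j)) (suc j) ⟩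
  expSum (ι (suc j) * (x * recip j)) (suc (suc j)) ≡⟨ cong (λ z → expSum z (suc (suc j))) (ι-suc-*-recip j x) ⟩
  expSum x (suc (suc j))                          ≤⟨ expSum-mono 0≤x le ⟩
  expSum x m                                      ∎
  where open ℚ.≤-Reasoning

range : ℕ → ℕ → List ℕ
range a zero    = []
range a (suc c) = a ∷ range (suc a) c

length-range : ∀ a c → length (range a c) ≡ c
length-range a zero    = refl
length-range a (suc c) = cong suc (length-range (suc a) c)

-- The product telescopes, as `1ℚ + recip i` is (i + 2)/(i + 1).
Π-range : ∀ a c → Π.over (range a c) (λ i → 1ℚ + recip i) * ι (suc a) ≡ ι (suc (a ℕ.+ c))
Π-range a zero    = trans (ℚ.*-identityˡ (ι (suc a))) (cong (ι ∘ suc) (sym (ℕ.+-identityʳ a)))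
Π-range a (suc c) = begin
  (1ℚ + recip a) * P * ι (suc a)                ≡⟨ solve 3 (λ r P i → (con 1ℚ :+ r) :* P :* i := P :* (i :* r :+ i)) refl (recip a) P (ι (suc a)) ⟩
  P * (ι (suc a) * recip a + ι (suc a))         ≡⟨ cong (λ z → P * (z + ι (suc a))) (ι-recip a) ⟩
  P * (1ℚ + ι (suc a))                          ≡⟨ cong (P *_) (ι-suc (suc a)) ⟨
  P * ι (suc (suc a))                           ≡⟨ Π-range (suc a) c ⟩
  ι (suc (suc a ℕ.+ c))                         ≡⟨ cong (ι ∘ suc) (sym (ℕ.+-suc a c)) ⟩
  ι (suc (a ℕ.+ suc c))                         ∎
  where
  open ≡-Reasoning
  P : ℚ
  P = Π.over (range (suc a) c) (λ i → 1ℚ + recip i)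

Σ-range : ∀ a c → harmonic a + Σ.over (range a c) recip ≡ harmonic (a ℕ.+ c)
Σ-range a zero    = trans (ℚ.+-identityʳ (harmonic a)) (cong harmonic (sym (ℕ.+-identityʳ a)))
Σ-range a (suc c) = begin
  harmonic a + (recip a + Σ.over (range (suc a) c) recip)   ≡⟨ ℚ.+-assoc (harmonic a) (recip a) _ ⟨
  harmonic (suc a) + Σ.over (range (suc a) c) recip         ≡⟨ Σ-range (suc a) c ⟩
  harmonic (suc a ℕ.+ c)                                    ≡⟨ cong harmonic (sym (ℕ.+-suc a c)) ⟩
  harmonic (a ℕ.+ suc c)                                    ∎
  where open ≡-Reasoning

0≤logSum : ∀ s n → 0ℚ ≤ℚ logSum (suc s) n
0≤logSum s n = p≤q⇒0≤q-p (increasing {harmonic} (λ k _ → p≤p+q (0≤recip k)) ℕ.z≤n (ℕ.m≤m+n (suc n) _))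

module _ (s n₀ : ℕ) where

  private
    c : ℕ
    c = s ℕ.* suc n₀
    factor : ℕ → ℚ
    factor i = 1ℚ + recip i

  Π-factors : Π.over (range n₀ c) factor ≡ ι (suc s)
  Π-factors = begin
    P                                      ≡⟨ ℚ.*-identityʳ P ⟨
    P * 1ℚ                                 ≡⟨ cong (P *_) (ι-recip n₀) ⟨
    P * (ι (suc n₀) * recip n₀)            ≡⟨ ℚ.*-assoc P (ι (suc n₀)) (recip n₀) ⟨
    P * ι (suc n₀) * recip n₀              ≡⟨ cong (_* recip n₀) (trans (Π-range n₀ c) (ι-* (suc s) (suc n₀))) ⟩
    ι (suc s) * ι (suc n₀) * recip n₀      ≡⟨ ℚ.*-assoc (ι (suc s)) (ι (suc n₀)) (recip n₀) ⟩
    ι (suc s) * (ι (suc n₀) * recip n₀)    ≡⟨ cong (ι (suc s) *_) (ι-recip n₀) ⟩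
    ι (suc s) * 1ℚ                         ≡⟨ ℚ.*-identityʳ (ι (suc s)) ⟩
    ι (suc s)                              ∎
    where
    open ≡-Reasoning
    P : ℚ
    P = Π.over (range n₀ c) factor

  -- A left Riemann sum of dx/x against the right one: they differ only in the end terms 1/(n₀ + 1)
  -- and 1/(n₀ + c + 1). The error `recip n₀` of the whole proof originates here.
  Σ-recips : Σ.over (range n₀ c) recip ≤ℚ logSum (suc s) n₀ + recip n₀
  Σ-recips = begin
    R                                                          ≤⟨ p≤p+q (0≤recip (n₀ ℕ.+ c)) ⟩
    R + recip (n₀ ℕ.+ c)                                       ≡⟨ solve 4 (λ R r h t → R :+ t := h :+ R :+ t :- (h :+ r) :+ r) refl R (recip n₀) (harmonic n₀) (recip (n₀ ℕ.+ c)) ⟩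
    harmonic n₀ + R + recip (n₀ ℕ.+ c) - harmonic (suc n₀) + recip n₀
      ≡⟨ cong (λ z → z + recip (n₀ ℕ.+ c) - harmonic (suc n₀) + recip n₀) (Σ-range n₀ c) ⟩
    logSum (suc s) n₀ + recip n₀                               ∎
    where
    open ℚ.≤-Reasoning
    R : ℚ
    R = Σ.over (range n₀ c) recip

  -- suc s = ∏ (1 + 1/k) over n₀ < k < (suc s)(suc n₀); pad this product with ones to
  -- suc j factors and apply the AM-GM inequality.
  ι≤[1+log/j]^j : ∀ {m j} → n₀ ≤ m → suc s ℕ.* suc n₀ ≤ suc j →
    ι (suc s) ≤ℚ (1ℚ + (logSum (suc s) m + recip n₀) * recip j) ^ suc j
  ι≤[1+log/j]^j {m} {j} n₀≤m le = begin
    ι (suc s)                            ≡⟨ ΠF≡ ⟨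
    Π.over F (λ i → 1ℚ + excess i)       ≤⟨ amgm F (λ i _ → +-nonNeg 0≤1ℚ (0≤excess i)) 0≤a ΣF≤ ⟩
    a ^ length F                         ≡⟨ cong (a ^_) length-F ⟩
    a ^ suc j                            ∎
    where
    open ℚ.≤-Reasoning
    y a : ℚ
    y = logSum (suc s) m + recip n₀
    a = 1ℚ + y * recip j
    c≤j : c ≤ suc j
    c≤j = ℕ.≤-trans (ℕ.m≤n+m c (suc n₀)) le
    padding : ℕ
    padding = suc j ℕ.∸ c
    F : List (Maybe ℕ)
    F = map just (range n₀ c) ++ replicate padding nothing
    excess : Maybe ℕ → ℚ
    excess = maybe recip 0ℚ
    0≤excess : ∀ i → 0ℚ ≤ℚ excess i
    0≤excess (just i) = 0≤recip i
    0≤excess nothing  = ℚ.≤-refl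
    0≤a : 0ℚ ≤ℚ a
    0≤a = +-nonNeg 0≤1ℚ (*-nonNeg (+-nonNeg (0≤logSum s m) (0≤recip n₀)) (0≤recip j))
    length-F : length F ≡ suc j
    length-F = trans (List.length-++ (map just (range n₀ c)))
      (trans (cong₂ ℕ._+_ (trans (List.length-map just (range n₀ c)) (length-range n₀ c))
                          (List.length-replicate padding))
             (ℕ.m+[n∸m]≡n c≤j))
    Π-padding : ∀ k → Π.over (replicate k nothing) (λ i → 1ℚ + excess i) ≡ 1ℚ
    Π-padding zero    = refl
    Π-padding (suc k) = trans (ℚ.*-identityˡ _) (Π-padding k)
    Σ-padding : ∀ k → Σ.over (replicate k nothing) excess ≡ 0ℚ
    Σ-padding zero    = refl
    Σ-padding (suc k) = trans (ℚ.+-identityˡ _) (Σ-padding k)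
    ΠF≡ : Π.over F (λ i → 1ℚ + excess i) ≡ ι (suc s)
    ΠF≡ = begin-equality
      Π.over F (λ i → 1ℚ + excess i)
        ≡⟨ Π.over-++ (map just (range n₀ c)) (replicate padding nothing) (λ i → 1ℚ + excess i) ⟩
      Π.over (map just (range n₀ c)) (λ i → 1ℚ + excess i) * Π.over (replicate padding nothing) (λ i → 1ℚ + excess i)
        ≡⟨ cong₂ _*_ (trans (Π.over-map just (range n₀ c) (λ i → 1ℚ + excess i)) Π-factors) (Π-padding padding) ⟩
      ι (suc s) * 1ℚ
        ≡⟨ ℚ.*-identityʳ (ι (suc s)) ⟩
      ι (suc s) ∎
    Σexcess≤ : Σ.over F excess ≤ℚ y
    Σexcess≤ = begin
      Σ.over F excess
        ≡⟨ Σ.over-++ (map just (range n₀ c)) (replicate padding nothing) excess ⟩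
      Σ.over (map just (range n₀ c)) excess + Σ.over (replicate padding nothing) excess
        ≡⟨ cong₂ _+_ (Σ.over-map just (range n₀ c) excess) (Σ-padding padding) ⟩
      Σ.over (range n₀ c) recip + 0ℚ
        ≡⟨ ℚ.+-identityʳ _ ⟩
      Σ.over (range n₀ c) recip
        ≤⟨ Σ-recips ⟩
      logSum (suc s) n₀ + recip n₀
        ≤⟨ ℚ.+-monoˡ-≤ (recip n₀) (increasing {logSum (suc s)} (λ k _ → logSum-increasing s k) ℕ.z≤n n₀≤m) ⟩
      y ∎
    ΣF≤ : Σ.over F (λ i → 1ℚ + excess i) ≤ℚ ι (length F) * a
    ΣF≤ = begin
      Σ.over F (λ i → 1ℚ + excess i)                 ≡⟨ Σ.over-∙ F (λ _ → 1ℚ) excess ⟩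
      Σ.over F (λ _ → 1ℚ) + Σ.over F excess          ≡⟨ cong (_+ Σ.over F excess) (Σ-const F 1ℚ) ⟩
      ι (length F) * 1ℚ + Σ.over F excess            ≤⟨ ℚ.+-monoʳ-≤ (ι (length F) * 1ℚ) Σexcess≤ ⟩
      ι (length F) * 1ℚ + y                          ≡⟨ cong (λ k → ι k * 1ℚ + y) length-F ⟩
      ι (suc j) * 1ℚ + y                             ≡⟨ cong (ι (suc j) * 1ℚ +_) (ι-suc-*-recip j y) ⟨
      ι (suc j) * 1ℚ + ι (suc j) * (y * recip j)     ≡⟨ ℚ.*-distribˡ-+ (ι (suc j)) 1ℚ (y * recip j) ⟨
      ι (suc j) * a                                  ≡⟨ cong (λ k → ι k * a) length-F ⟨
      ι (length F) * a                               ∎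

Σ-1- : ∀ {A : Set} (xs : List A) g →
  Σ.over xs (λ x → 1ℚ - g x) ≡ ι (length xs) * 1ℚ - Σ.over xs g
Σ-1- []       g = cong (λ z → z * 1ℚ - 0ℚ) (sym ι-0)
Σ-1- (x ∷ xs) g = begin
  (1ℚ - g x) + Σ.over xs (λ y → 1ℚ - g y)      ≡⟨ cong ((1ℚ - g x) +_) (Σ-1- xs g) ⟩
  (1ℚ - g x) + (k * 1ℚ - Σ.over xs g)          ≡⟨ solve 3 (λ k p q → (con 1ℚ :- p) :+ (k :* con 1ℚ :- q) := (con 1ℚ :+ k) :* con 1ℚ :- (p :+ q)) refl k (g x) (Σ.over xs g) ⟩
  (1ℚ + k) * 1ℚ - (g x + Σ.over xs g)          ≡⟨ cong (λ z → z * 1ℚ - (g x + Σ.over xs g)) (ι-suc (length xs)) ⟨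
  ι (suc (length xs)) * 1ℚ - Σ.over (x ∷ xs) g ∎
  where
  open ≡-Reasoning
  k : ℚ
  k = ι (length xs)

-- Convexity

inverse : ∀ g → 1ℚ ≤ℚ g → ∃ λ i → i * g ≡ 1ℚ × 0ℚ ≤ℚ i × i ≤ℚ 1ℚ
inverse g 1≤g = i , i*g≡1 , 0≤i , (begin
  i         ≡⟨ ℚ.*-identityʳ i ⟨
  i * 1ℚ    ≤⟨ *-monoˡ 0≤i 1≤g ⟩
  i * g     ≡⟨ i*g≡1 ⟩
  1ℚ        ∎)
  where
  open ℚ.≤-Reasoning
  0<g : 0ℚ <ℚ g
  0<g = ℚ.<-≤-trans (ℚ.positive⁻¹ 1ℚ) 1≤g
  instance
    g≢0 : ℚ.NonZero g
    g≢0 = ℚ.>-nonZero 0<g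
    g>0 : ℚ.Positive g
    g>0 = ℚ.positive 0<g
  i : ℚ
  i = ℚ.1/ g
  i*g≡1 : i * g ≡ 1ℚ
  i*g≡1 = ℚ.*-inverseˡ g
  0≤i : 0ℚ ≤ℚ i
  0≤i = ℚ.nonNegative⁻¹ i {{ℚ.pos⇒nonNeg i {{ℚ.1/pos⇒pos g}}}}

module _ {B : Set} (V : List B) (J : ℕ) where

  -- ∏ ρᵥᴶ (1 + J ∑ (1 − ρᵥ)) ≤ 1 replaces the tangent line e⁻ˣ ≥ 1 − x at the mean.
  tangent : ∀ {ρ : B → ℚ} → (∀ v → 0ℚ ≤ℚ ρ v) →
    let T = 1ℚ + ι J * Σ.over V (λ v → 1ℚ - ρ v) in
    0ℚ ≤ℚ T → T * Π.over V ρ ^ J ≤ℚ 1ℚ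
  tangent {ρ} 0≤ρ 0≤T = begin
    -- `T` depends on `ρ` only through its mean `a`. Once AM-GM has replaced the product by `a ^ K`,
    -- what remains is `bernoulli` for `a` and 1 with exponent JK.
    T * Π.over V ρ ^ J                                 ≤⟨ *-monoˡ 0≤T (^-mono (Π-nonNeg V (λ v _ → 0≤ρ v)) (amgm V (λ v _ → 0≤ρ v) 0≤a (ℚ.≤-reflexive mean)) J) ⟩
    T * (a ^ K) ^ J                                    ≡⟨ cong₂ _*_ T≡ (trans (^-assocʳ a K J) (cong (a ^_) (ℕ.*-comm K J))) ⟩
    (ι (suc (J ℕ.* K)) * 1ℚ - ι (J ℕ.* K) * a) * a ^ (J ℕ.* K)  ≤⟨ bernoulli 0≤a 0≤1ℚ (J ℕ.* K) ⟩
    1ℚ ^ suc (J ℕ.* K)                                 ≡⟨ 1^n≡1 (suc (J ℕ.* K)) ⟩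
    1ℚ                                                 ∎
    where
    open ℚ.≤-Reasoning
    K : ℕ
    K = length V
    S a T : ℚ
    S = Σ.over V ρ
    a = S * recip (ℕ.pred K)
    T = 1ℚ + ι J * Σ.over V (λ v → 1ℚ - ρ v)
    mean : S ≡ ι K * a
    mean = Σ-mean V ρ
    0≤a : 0ℚ ≤ℚ a
    0≤a = *-nonNeg (Σ-nonNeg V (λ v _ → 0≤ρ v)) (0≤recip _)
    T≡ : T ≡ ι (suc (J ℕ.* K)) * 1ℚ - ι (J ℕ.* K) * a
    T≡ = begin-equality
      1ℚ + ι J * Σ.over V (λ v → 1ℚ - ρ v)      ≡⟨ cong (λ z → 1ℚ + ι J * z) (Σ-1- V ρ) ⟩
      1ℚ + ι J * (ι K * 1ℚ - S)                 ≡⟨ cong (λ z → 1ℚ + ι J * (ι K * 1ℚ - z)) mean ⟩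
      1ℚ + ι J * (ι K * 1ℚ - ι K * a)           ≡⟨ solve 3 (λ j k a → con 1ℚ :+ j :* (k :* con 1ℚ :- k :* a) := (con 1ℚ :+ j :* k) :* con 1ℚ :- j :* k :* a) refl (ι J) (ι K) a ⟩
      (1ℚ + ι J * ι K) * 1ℚ - ι J * ι K * a     ≡⟨ cong (λ z → (1ℚ + z) * 1ℚ - z * a) (ι-* J K) ⟨
      (1ℚ + ι (J ℕ.* K)) * 1ℚ - ι (J ℕ.* K) * a ≡⟨ cong (λ z → z * 1ℚ - ι (J ℕ.* K) * a) (ι-suc (J ℕ.* K)) ⟨
      ι (suc (J ℕ.* K)) * 1ℚ - ι (J ℕ.* K) * a  ∎

  -- The roles in the application: `w ω v` is 1/N, `h ω v` stands for the J-th root of N, and `g v`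
  -- is its mean over `Ω` up to the error `ε`. The bound `1≤g` keeps the error from growing when it
  -- is divided by `g v`.
  module _ {A : Set} (Ω : List A) (g : B → ℚ) (w h : A → B → ℚ) (ε : ℚ)
    (1≤g : ∀ v → 1ℚ ≤ℚ g v) (0≤w : ∀ ω v → 0ℚ ≤ℚ w ω v) (0≤h : ∀ ω v → 0ℚ ≤ℚ h ω v) (0≤ε : 0ℚ ≤ℚ ε)
    (1≤hᴶw : ∀ ω → ω ∈ Ω → ∀ v → 1ℚ ≤ℚ h ω v ^ J * w ω v)
    (Σh≤ : ∀ v → Σ.over Ω (λ ω → h ω v) ≤ℚ ι (length Ω) * (g v + ε)) where

    private
      W G : ℚ
      W = ι (length Ω)
      G = Π.over V g ^ J
      0≤g : ∀ v → 0ℚ ≤ℚ g v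
      0≤g v = ℚ.≤-trans 0≤1ℚ (1≤g v)
      0≤G : 0ℚ ≤ℚ G
      0≤G = ^-nonNeg (Π-nonNeg V (λ v _ → 0≤g v)) J
      g⁻¹ : B → ℚ
      g⁻¹ v = proj₁ (inverse (g v) (1≤g v))
      g⁻¹*g : ∀ v → g⁻¹ v * g v ≡ 1ℚ
      g⁻¹*g v = proj₁ (proj₂ (inverse (g v) (1≤g v)))
      0≤g⁻¹ : ∀ v → 0ℚ ≤ℚ g⁻¹ v
      0≤g⁻¹ v = proj₁ (proj₂ (proj₂ (inverse (g v) (1≤g v))))
      g⁻¹≤1 : ∀ v → g⁻¹ v ≤ℚ 1ℚ
      g⁻¹≤1 v = proj₂ (proj₂ (proj₂ (inverse (g v) (1≤g v))))
      ρ : A → B → ℚ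
      ρ ω v = h ω v * g⁻¹ v
      0≤ρ : ∀ ω v → 0ℚ ≤ℚ ρ ω v
      0≤ρ ω v = *-nonNeg (0≤h ω v) (0≤g⁻¹ v)
      T : A → ℚ
      T ω = 1ℚ + ι J * Σ.over V (λ v → 1ℚ - ρ ω v)

      -- As h = ρg, the hypothesis `1≤hᴶw` allows multiplication by (∏ρ)ᴶ · G · ∏w, and `tangent`
      -- then cancels `T ω` against (∏ρ)ᴶ. The tangent estimate is multiplied by `T ω`, hence the
      -- case split on its sign.
      T≤ : ∀ ω → ω ∈ Ω → T ω ≤ℚ G * Π.over V (w ω)
      T≤ ω ω∈ with ℚ.≤-total 0ℚ (T ω)
      ... | inj₂ T≤0 = ℚ.≤-trans T≤0 (*-nonNeg 0≤G (Π-nonNeg V (λ v _ → 0≤w ω v)))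
      ... | inj₁ 0≤T = begin
        T ω                                       ≡⟨ ℚ.*-identityʳ (T ω) ⟨
        T ω * 1ℚ                                  ≡⟨ cong (T ω *_) (Π.over-ε V) ⟨
        T ω * Π.over V (λ _ → 1ℚ)                 ≤⟨ *-monoˡ 0≤T (Π-mono V (λ _ _ → 0≤1ℚ) (λ v _ → 1≤hᴶw ω ω∈ v)) ⟩
        T ω * Π.over V (λ v → h ω v ^ J * w ω v)  ≡⟨ cong (T ω *_) Πhw ⟩
        T ω * (P * G * Q)                         ≡⟨ solve 4 (λ t p g q → t :* (p :* g :* q) := t :* p :* (g :* q)) refl (T ω) P G Q ⟩
        T ω * P * (G * Q)                         ≤⟨ *-monoʳ (*-nonNeg 0≤G (Π-nonNeg V (λ v _ → 0≤w ω v))) (tangent (0≤ρ ω) 0≤T) ⟩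
        1ℚ * (G * Q)                              ≡⟨ ℚ.*-identityˡ (G * Q) ⟩
        G * Q                                     ∎
        where
        open ℚ.≤-Reasoning
        P Q : ℚ
        P = Π.over V (ρ ω) ^ J
        Q = Π.over V (w ω)
        h≡ρg : ∀ v → h ω v ≡ ρ ω v * g v
        h≡ρg v = sym (trans (ℚ.*-assoc (h ω v) (g⁻¹ v) (g v))
          (trans (cong (h ω v *_) (g⁻¹*g v)) (ℚ.*-identityʳ (h ω v))))
        Πhw : Π.over V (λ v → h ω v ^ J * w ω v) ≡ P * G * Q
        Πhw = begin-equality
          Π.over V (λ v → h ω v ^ J * w ω v)             ≡⟨ Π.over-∙ V (λ v → h ω v ^ J) (w ω) ⟩
          Π.over V (λ v → h ω v ^ J) * Q                 ≡⟨ cong (_* Q) (Π-^ V (h ω) J) ⟩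
          Π.over V (h ω) ^ J * Q                         ≡⟨ cong (λ z → z ^ J * Q) (Π.over-cong V (λ v _ → h≡ρg v)) ⟩
          Π.over V (λ v → ρ ω v * g v) ^ J * Q           ≡⟨ cong (λ z → z ^ J * Q) (Π.over-∙ V (ρ ω) g) ⟩
          (Π.over V (ρ ω) * Π.over V g) ^ J * Q          ≡⟨ cong (_* Q) (^-distrib-* (Π.over V (ρ ω)) (Π.over V g) J) ⟩
          P * G * Q                                      ∎

      Σρ≤ : ∀ v → Σ.over Ω (λ ω → ρ ω v) ≤ℚ W * 1ℚ + W * ε
      Σρ≤ v = begin
        Σ.over Ω (λ ω → h ω v * g⁻¹ v)          ≡⟨ *-distribʳ-Σ (g⁻¹ v) Ω (λ ω → h ω v) ⟨
        Σ.over Ω (λ ω → h ω v) * g⁻¹ v          ≤⟨ *-monoʳ (0≤g⁻¹ v) (Σh≤ v) ⟩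
        W * (g v + ε) * g⁻¹ v                   ≡⟨ solve 4 (λ w g e i → w :* (g :+ e) :* i := w :* (i :* g) :+ w :* e :* i) refl W (g v) ε (g⁻¹ v) ⟩
        W * (g⁻¹ v * g v) + W * ε * g⁻¹ v       ≤⟨ ℚ.+-mono-≤ (ℚ.≤-reflexive (cong (W *_) (g⁻¹*g v))) (*-monoˡ (*-nonNeg (0≤ι (length Ω)) 0≤ε) (g⁻¹≤1 v)) ⟩
        W * 1ℚ + W * ε * 1ℚ                     ≡⟨ cong (W * 1ℚ +_) (ℚ.*-identityʳ (W * ε)) ⟩
        W * 1ℚ + W * ε                          ∎
        where open ℚ.≤-Reasoning

    -- `T` is affine in `ρ`, so its sum over `Ω` sees only the means of `ρ`, each of which exceeds 1
    -- by at most `ε`.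
    jensen : W * (1ℚ - ι (length V) * (ι J * ε)) ≤ℚ G * Σ.over Ω (λ ω → Π.over V (w ω))
    jensen = begin
      W * (1ℚ - ι (length V) * (ι J * ε))
        ≡⟨ solve 4 (λ w k j e → w :* (con 1ℚ :- k :* (j :* e)) := w :* con 1ℚ :+ j :* (k :* (:- (w :* e)))) refl W (ι (length V)) (ι J) ε ⟩
      W * 1ℚ + ι J * (ι (length V) * (- (W * ε)))
        ≡⟨ cong (λ z → W * 1ℚ + ι J * z) (Σ-const V (- (W * ε))) ⟨
      W * 1ℚ + ι J * Σ.over V (λ _ → - (W * ε))
        ≤⟨ ℚ.+-monoʳ-≤ (W * 1ℚ) (*-monoˡ (0≤ι J) (Σ-mono V (λ v _ → bound v))) ⟩
      W * 1ℚ + ι J * Σ.over V (λ v → Σ.over Ω (λ ω → 1ℚ - ρ ω v))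
        ≡⟨ cong (λ z → W * 1ℚ + ι J * z) (Σ.over-swap V Ω (λ v ω → 1ℚ - ρ ω v)) ⟩
      W * 1ℚ + ι J * Σ.over Ω (λ ω → Σ.over V (λ v → 1ℚ - ρ ω v))
        ≡⟨ cong₂ _+_ (sym (Σ-const Ω 1ℚ)) (*-distribˡ-Σ (ι J) Ω _) ⟩
      Σ.over Ω (λ _ → 1ℚ) + Σ.over Ω (λ ω → ι J * Σ.over V (λ v → 1ℚ - ρ ω v))
        ≡⟨ Σ.over-∙ Ω (λ _ → 1ℚ) (λ ω → ι J * Σ.over V (λ v → 1ℚ - ρ ω v)) ⟨
      Σ.over Ω T
        ≤⟨ Σ-mono Ω T≤ ⟩
      Σ.over Ω (λ ω → G * Π.over V (w ω))
        ≡⟨ *-distribˡ-Σ G Ω _ ⟨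
      G * Σ.over Ω (λ ω → Π.over V (w ω)) ∎
      where
      open ℚ.≤-Reasoning
      bound : ∀ v → - (W * ε) ≤ℚ Σ.over Ω (λ ω → 1ℚ - ρ ω v)
      bound v = begin
        - (W * ε)                                  ≡⟨ solve 2 (λ a b → :- b := a :- (a :+ b)) refl (W * 1ℚ) (W * ε) ⟩
        W * 1ℚ - (W * 1ℚ + W * ε)                  ≤⟨ ℚ.+-monoʳ-≤ (W * 1ℚ) (ℚ.neg-antimono-≤ (Σρ≤ v)) ⟩
        W * 1ℚ - Σ.over Ω (λ ω → ρ ω v)            ≡⟨ Σ-1- Ω (λ ω → ρ ω v) ⟨
        Σ.over Ω (λ ω → 1ℚ - ρ ω v)                ∎

-- Counting with Boolean predicates

ι-1 : ι 1 ≡ 1ℚ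
ι-1 = trans (ι-suc 0) (trans (cong (1ℚ +_) ι-0) (ℚ.+-identityʳ 1ℚ))

bit : Bool → ℕ
bit true  = 1
bit false = 0

count : ∀ {A : Set} → (A → Bool) → List A → ℕ
count Q xs = #.over xs (bit ∘ Q)

count-all-false : ∀ {A : Set} {Q : A → Bool} xs → All (λ x → Q x ≡ false) xs → count Q xs ≡ 0
count-all-false []       []         = refl
count-all-false (x ∷ xs) (Qx ∷ Qxs) = cong₂ (λ b k → bit b ℕ.+ k) Qx (count-all-false xs Qxs)

Σ-bits : ∀ {A : Set} (xs : List A) Q c → Σ.over xs (λ x → ι (bit (Q x)) * c) ≡ ι (count Q xs) * c
Σ-bits []       Q c = sym (trans (cong (_* c) ι-0) (ℚ.*-zeroˡ c))
Σ-bits (x ∷ xs) Q c = begin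
  ι (bit (Q x)) * c + Σ.over xs (λ x → ι (bit (Q x)) * c)  ≡⟨ cong (ι (bit (Q x)) * c +_) (Σ-bits xs Q c) ⟩
  ι (bit (Q x)) * c + ι (count Q xs) * c                   ≡⟨ ℚ.*-distribʳ-+ c (ι (bit (Q x))) (ι (count Q xs)) ⟨
  (ι (bit (Q x)) + ι (count Q xs)) * c                     ≡⟨ cong (_* c) (ι-+ (bit (Q x)) (count Q xs)) ⟨
  ι (count Q (x ∷ xs)) * c                                 ∎
  where open ≡-Reasoning

-- Random orders

Unique-resp-↭ : ∀ {A : Set} {xs ys : List A} → xs ↭ ys → Unique xs → Unique ys
Unique-resp-↭ p = ↭ₛ.Unique-resp-↭ (setoid _) (↭⇒↭ₛ p)

module _ {A : Set} where

  selections : List A → List (A × List A)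
  selections []       = []
  selections (x ∷ xs) = (x , xs) ∷ map (λ { (y , ys) → y , x ∷ ys }) (selections xs)

  selections-↭ : ∀ xs {x r} → (x , r) ∈ selections xs → x ∷ r ↭ xs
  selections-↭ (x ∷ xs) (here refl) = ↭.refl
  selections-↭ (x ∷ xs) (there p) with ∈-map⁻ _ p
  ... | (y , ys) , q , refl = ↭.trans (↭.swap y x ↭.refl) (↭.prep x (selections-↭ xs q))

  Σ-selections : ∀ xs (g : A → ℚ) → Σ.over (selections xs) (g ∘ proj₁) ≡ Σ.over xs g
  Σ-selections []       g = refl
  Σ-selections (x ∷ xs) g = cong (g x +_)
    (trans (Σ.over-map _ (selections xs) (g ∘ proj₁)) (Σ-selections xs g))

  -- The number carries the recursion, since the remainder of a selection is not a structural part
  -- of the list; it is meant to be the length of the list.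
  permutations : ℕ → List A → List (List A)
  permutations zero    xs = [] ∷ []
  permutations (suc k) xs = concatMap (λ { (x , r) → map (x ∷_) (permutations k r) }) (selections xs)

  permutations-↭ : ∀ k {xs σ} → length xs ≡ k → σ ∈ permutations k xs → σ ↭ xs
  permutations-↭ zero    {[]} _  (here refl) = ↭.refl
  permutations-↭ (suc k) {xs} len σ∈ with find (∈-concatMap⁻ _ {xs = selections xs} σ∈)
  ... | (x , r) , x∈ , σ∈map with ∈-map⁻ (x ∷_) σ∈map
  ...   | τ , τ∈ , refl = ↭.trans (↭.prep x (permutations-↭ k len′ τ∈)) p
    where
    p : x ∷ r ↭ xs
    p = selections-↭ xs x∈
    len′ : length r ≡ k
    len′ = ℕ.suc-injective (trans (↭.↭-length p) len)

  Σ-permutations : ∀ k xs (g : List A → ℚ) → Σ.over (permutations (suc k) xs) g ≡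
    Σ.over (selections xs) (λ { (x , r) → Σ.over (permutations k r) (λ σ → g (x ∷ σ)) })
  Σ-permutations k xs g = trans
    (Σ.over-concatMap _ (selections xs) g)
    (Σ.over-cong (selections xs) (λ { (x , r) _ → Σ.over-map (x ∷_) (permutations k r) g }))

  length-permutations : ∀ k {xs} → length xs ≡ k → ι (length (permutations k xs)) ≡ ι (k !)
  length-permutations zero    _   = refl
  length-permutations (suc k) {xs} len = begin
    ι (length (permutations (suc k) xs))                     ≡⟨ ℚ.*-identityʳ _ ⟨
    ι (length (permutations (suc k) xs)) * 1ℚ                ≡⟨ Σ-const (permutations (suc k) xs) 1ℚ ⟨
    Σ.over (permutations (suc k) xs) (λ _ → 1ℚ)              ≡⟨ Σ-permutations k xs (λ _ → 1ℚ) ⟩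
    Σ.over (selections xs) (λ { (x , r) → Σ.over (permutations k r) (λ σ → 1ℚ) })
      ≡⟨ Σ.over-cong (selections xs) (λ { (x , r) x∈ → trans (Σ-const (permutations k r) 1ℚ)
           (cong (_* 1ℚ) (length-permutations k (ℕ.suc-injective (trans (↭.↭-length (selections-↭ xs x∈)) len)))) }) ⟩
    Σ.over (selections xs) (λ _ → ι (k !) * 1ℚ)              ≡⟨ Σ-selections xs (λ _ → ι (k !) * 1ℚ) ⟩
    Σ.over xs (λ _ → ι (k !) * 1ℚ)                           ≡⟨ Σ-const xs (ι (k !) * 1ℚ) ⟩
    ι (length xs) * (ι (k !) * 1ℚ)                           ≡⟨ cong₂ _*_ (cong ι len) (ℚ.*-identityʳ (ι (k !))) ⟩
    ι (suc k) * ι (k !)                                      ≡⟨ ι-* (suc k) (k !) ⟨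
    ι (suc k !)                                              ∎
    where open ≡-Reasoning

module Order {A : Set} (_≟_ : DecidableEquality A) where

  before from : A → List A → List A
  before a []       = []
  before a (x ∷ xs) = if does (x ≟ a) then [] else x ∷ before a xs
  from   a []       = []
  from   a (x ∷ xs) = if does (x ≟ a) then x ∷ xs else from a xs

  before++from : ∀ a xs → before a xs ++ from a xs ≡ xs
  before++from a []       = refl
  before++from a (x ∷ xs) with does (x ≟ a)
  ... | true  = refl
  ... | false = cong (x ∷_) (before++from a xs)

  private
    _==_ : A → A → Bool
    x == a = does (x ≟ a)

  count-== : ∀ {a xs} → Unique xs → a ∈ xs → count (_== a) xs ≡ 1
  count-== {a} (a∉ ∷ _) (here refl) = cong₂ (λ b k → bit b ℕ.+ k) (dec-true (a ≟ a) refl)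
    (count-all-false _ (All.map (λ {x} a≢x → dec-false (x ≟ a) (a≢x ∘ sym)) a∉))
  count-== {a} {x ∷ xs} (x∉ ∷ xs!) (there a∈) = cong₂ (λ b k → bit b ℕ.+ k)
    (dec-false (x ≟ a) (All.lookup x∉ a∈)) (count-== xs! a∈)

  ∈⇒0<count : ∀ {Q : A → Bool} {a xs} → a ∈ xs → Q a ≡ true → ∃ λ p → count Q xs ≡ suc p
  ∈⇒0<count {Q} {a} {_ ∷ xs} (here refl) Qa = count Q xs , cong (λ b → bit b ℕ.+ count Q xs) Qa
  ∈⇒0<count {Q} {a} {x ∷ xs} (there a∈) Qa with ∈⇒0<count a∈ Qa
  ... | p , e = bit (Q x) ℕ.+ p , trans (cong (bit (Q x) ℕ.+_) e) (ℕ.+-suc (bit (Q x)) p)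

  -- In a random order, the number of elements of Q from a ∈ Q on is uniform on 1, …, ∣Q∣.
  module _ {ψ F : ℕ → ℚ} (rec : ∀ q → ι (suc q) * F (suc q) ≡ ι q * F q + ψ (suc q)) where

    Σ-count-from : ∀ {Q : A → Bool} {a} → Q a ≡ true → ∀ k {xs} → length xs ≡ k → Unique xs → a ∈ xs →
      Σ.over (permutations k xs) (λ σ → ψ (count Q (from a σ))) ≡ ι (k !) * F (count Q xs)
    Σ-count-from {Q} {a} Qa zero    {[]} _   _   ()
    Σ-count-from {Q} {a} Qa (suc k) {xs} len xs! a∈ with ∈⇒0<count {Q} a∈ Qa
    ... | p , count≡ = begin
      Σ.over (permutations (suc k) xs) (λ σ → ψ (count Q (from a σ)))
        ≡⟨ Σ-permutations k xs (λ σ → ψ (count Q (from a σ))) ⟩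
      Σ.over (selections xs) (λ { (x , r) → Σ.over (permutations k r) (λ σ → ψ (count Q (from a (x ∷ σ)))) })
        ≡⟨ Σ.over-cong (selections xs) (λ { (x , r) x∈ → term x∈ }) ⟩
      Σ.over (selections xs) (λ { (x , r) → ι (k !) * g x })
        ≡⟨ Σ-selections xs (λ x → ι (k !) * g x) ⟩
      Σ.over xs (λ x → ι (k !) * g x)
        ≡⟨ *-distribˡ-Σ (ι (k !)) xs g ⟨
      ι (k !) * Σ.over xs g
        ≡⟨ cong (ι (k !) *_) Σg ⟩
      ι (k !) * (ι (suc k) * F (suc p))
        ≡⟨ solve 3 (λ a b c → a :* (b :* c) := b :* a :* c) refl (ι (k !)) (ι (suc k)) (F (suc p)) ⟩
      ι (suc k) * ι (k !) * F (suc p)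
        ≡⟨ cong (_* F (suc p)) (ι-* (suc k) (k !)) ⟨
      ι (suc k !) * F (suc p)
        ≡⟨ cong (λ q → ι (suc k !) * F q) count≡ ⟨
      ι (suc k !) * F (count Q xs) ∎
      where
      open ≡-Reasoning
      -- `g x` is the average conditional on the first element `x`: F (p + 1) if x lies outside Q, F
      -- p if x lies in Q but is not `a`, and ψ (p + 1) if x is `a`. Written as a combination of
      -- indicators, it can be summed by counting.
      D E : ℚ
      D = F p - F (suc p)
      E = ψ (suc p) - F p
      g : A → ℚ
      g x = F (suc p) + (ι (bit (Q x)) * D + ι (bit (x == a)) * E)

      g-when : ∀ x {q e} → Q x ≡ q → x == a ≡ e → g x ≡ F (suc p) + (ι (bit q) * D + ι (bit e) * E)
      g-when x refl refl = refl

      term : ∀ {x r} → (x , r) ∈ selections xs →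
        Σ.over (permutations k r) (λ σ → ψ (count Q (from a (x ∷ σ)))) ≡ ι (k !) * g x
      term {x} {r} x∈ = go (x ≟ a)
        where
        x∷r↭xs : x ∷ r ↭ xs
        x∷r↭xs = selections-↭ xs x∈
        len′ : length r ≡ k
        len′ = ℕ.suc-injective (trans (↭.↭-length x∷r↭xs) len)
        r! : Unique r
        r! = AllPairs.tail (Unique-resp-↭ (↭-sym x∷r↭xs) xs!)
        count-r : bit (Q x) ℕ.+ count Q r ≡ suc p
        count-r = trans (#.over-↭ x∷r↭xs (bit ∘ Q)) count≡
        from-∷ : ∀ {e} → x == a ≡ e → Σ.over (permutations k r) (λ σ → ψ (count Q (from a (x ∷ σ)))) ≡
          Σ.over (permutations k r) (λ σ → ψ (count Q (if e then x ∷ σ else from a σ)))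
        from-∷ refl = refl
        F-count : ∀ b → bit b ℕ.+ count Q r ≡ suc p →
          F (count Q r) ≡ F (suc p) + (ι (bit b) * D + ι 0 * E)
        F-count true  eq = begin
          F (count Q r)                            ≡⟨ cong F (ℕ.suc-injective eq) ⟩
          F p                                      ≡⟨ solve 3 (λ p s e → p := s :+ (con 1ℚ :* (p :- s) :+ con 0ℚ :* e)) refl (F p) (F (suc p)) E ⟩
          F (suc p) + (1ℚ * D + 0ℚ * E)            ≡⟨ cong₂ (λ u v → F (suc p) + (u * D + v * E)) ι-1 ι-0 ⟨
          F (suc p) + (ι 1 * D + ι 0 * E)          ∎
        F-count false eq = begin
          F (count Q r)                            ≡⟨ cong F eq ⟩
          F (suc p)                                ≡⟨ solve 3 (λ s d e → s := s :+ (con 0ℚ :* d :+ con 0ℚ :* e)) refl (F (suc p)) D E ⟩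
          F (suc p) + (0ℚ * D + 0ℚ * E)            ≡⟨ cong₂ (λ u v → F (suc p) + (u * D + v * E)) ι-0 ι-0 ⟨
          F (suc p) + (ι 0 * D + ι 0 * E)          ∎
        go : Dec (x ≡ a) → Σ.over (permutations k r) (λ σ → ψ (count Q (from a (x ∷ σ)))) ≡ ι (k !) * g x
        go (yes x≡a) = begin
          Σ.over (permutations k r) (λ σ → ψ (count Q (from a (x ∷ σ))))
            ≡⟨ from-∷ (dec-true (x ≟ a) x≡a) ⟩
          Σ.over (permutations k r) (λ σ → ψ (count Q (x ∷ σ)))
            ≡⟨ Σ.over-cong (permutations k r) (λ σ σ∈ → cong ψ (trans
                 (#.over-↭ (↭.trans (↭.prep x (permutations-↭ k len′ σ∈)) x∷r↭xs) (bit ∘ Q)) count≡)) ⟩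
          Σ.over (permutations k r) (λ _ → ψ (suc p))
            ≡⟨ Σ-const (permutations k r) (ψ (suc p)) ⟩
          ι (length (permutations k r)) * ψ (suc p)
            ≡⟨ cong₂ _*_ (length-permutations k len′) (begin
                 ψ (suc p)                            ≡⟨ solve 3 (λ s p f → s := f :+ (con 1ℚ :* (p :- f) :+ con 1ℚ :* (s :- p))) refl (ψ (suc p)) (F p) (F (suc p)) ⟩
                 F (suc p) + (1ℚ * D + 1ℚ * E)        ≡⟨ cong (λ u → F (suc p) + (u * D + u * E)) ι-1 ⟨
                 F (suc p) + (ι 1 * D + ι 1 * E)      ≡⟨ g-when x (trans (cong Q x≡a) Qa) (dec-true (x ≟ a) x≡a) ⟨
                 g x                                  ∎) ⟩
          ι (k !) * g x ∎
        go (no x≢a) = begin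
          Σ.over (permutations k r) (λ σ → ψ (count Q (from a (x ∷ σ))))
            ≡⟨ from-∷ (dec-false (x ≟ a) x≢a) ⟩
          Σ.over (permutations k r) (λ σ → ψ (count Q (from a σ)))
            ≡⟨ Σ-count-from {Q} Qa k len′ r! a∈r ⟩
          ι (k !) * F (count Q r)
            ≡⟨ cong (ι (k !) *_) (trans (F-count (Q x) count-r) (sym (g-when x refl (dec-false (x ≟ a) x≢a)))) ⟩
          ι (k !) * g x ∎
          where
          a∈r : a ∈ r
          a∈r with ↭.∈-resp-↭ (↭-sym x∷r↭xs) a∈
          ... | here a≡x   = contradiction (sym a≡x) x≢a
          ... | there a∈r′ = a∈r′

      -- The indicators contribute (p + 1)D + E, that is pF(p) + ψ(p + 1) - (p + 1)F(p + 1), which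
      -- is zero by `rec`.
      Σg : Σ.over xs g ≡ ι (suc k) * F (suc p)
      Σg = begin
        Σ.over xs g
          ≡⟨ trans (Σ.over-∙ xs (λ _ → F (suc p)) (λ x → ι (bit (Q x)) * D + ι (bit (x == a)) * E))
               (cong₂ _+_ (Σ-const xs (F (suc p))) (Σ.over-∙ xs (λ x → ι (bit (Q x)) * D) (λ x → ι (bit (x == a)) * E))) ⟩
        ι (length xs) * F (suc p) + (Σ.over xs (λ x → ι (bit (Q x)) * D) + Σ.over xs (λ x → ι (bit (x == a)) * E))
          ≡⟨ cong₂ (λ s t → ι (length xs) * F (suc p) + (s + t)) (Σ-bits xs Q D) (Σ-bits xs (_== a) E) ⟩
        ι (length xs) * F (suc p) + (ι (count Q xs) * D + ι (count (_== a) xs) * E)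
          ≡⟨ cong₂ (λ q e → ι (length xs) * F (suc p) + (q + e * E))
               (trans (cong (λ q → ι q * D) count≡) (trans (ℚ.*-distribˡ-+ (ι (suc p)) (F p) (- F (suc p)))
                  (cong₂ _+_ (ι-suc-* p (F p)) (trans (sym (ℚ.neg-distribʳ-* (ι (suc p)) (F (suc p)))) (cong -_ (rec p))))))
               (trans (cong ι (count-== xs! a∈)) ι-1) ⟩
        ι (length xs) * F (suc p) + ((F p + ι p * F p) - (ι p * F p + ψ (suc p)) + 1ℚ * (ψ (suc p) - F p))
          ≡⟨ solve 4 (λ l f i s → l :+ ((f :+ i) :- (i :+ s) :+ con 1ℚ :* (s :- f)) := l) refl
               (ι (length xs) * F (suc p)) (F p) (ι p * F p) (ψ (suc p)) ⟩
        ι (length xs) * F (suc p)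
          ≡⟨ cong (λ k → ι k * F (suc p)) len ⟩
        ι (suc k) * F (suc p) ∎

-- Counts and existence

count-≤1 : ∀ {A : Set} {Q : A → Bool} xs → count Q xs ≤ 1 → count Q xs ≡ bit (any Q xs)
count-≤1 []       _ = refl
count-≤1 {Q = Q} (x ∷ xs) le with Q x
... | false = count-≤1 xs le
... | true  = cong suc (ℕ.n≤0⇒n≡0 (ℕ.≤-pred le))

count-mono : ∀ {A : Set} {Q R : A → Bool} xs → (∀ x → Q x ≡ true → R x ≡ true) → count Q xs ≤ count R xs
count-mono []       _ = ℕ.z≤n
count-mono {Q = Q} {R} (x ∷ xs) Q⇒R = ℕ.+-mono-≤ (bit-mono (Q x) (R x) (Q⇒R x)) (count-mono xs Q⇒R)
  where
  bit-mono : ∀ b c → (b ≡ true → c ≡ true) → bit b ≤ bit c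
  bit-mono false c b⇒c = ℕ.z≤n
  bit-mono true  c b⇒c = ℕ.≤-reflexive (cong bit (sym (b⇒c refl)))

count-≤-length : ∀ {A : Set} (Q : A → Bool) xs → count Q xs ≤ length xs
count-≤-length Q []       = ℕ.z≤n
count-≤-length Q (x ∷ xs) with Q x
... | false = ℕ.m≤n⇒m≤1+n (count-≤-length Q xs)
... | true  = ℕ.s≤s (count-≤-length Q xs)

any-true : ∀ {A : Set} {Q : A → Bool} {x xs} → x ∈ xs → Q x ≡ true → any Q xs ≡ true
any-true {Q = Q} {x} {_ ∷ xs} (here refl) Qx = cong (_∨ any Q xs) Qx
any-true {Q = Q} {x} {y ∷ xs} (there x∈)  Qx = trans (cong (Q y ∨_) (any-true {Q = Q} x∈ Qx)) (Bool.∨-zeroʳ (Q y))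

any-false : ∀ {A : Set} {Q : A → Bool} xs → (∀ x → x ∈ xs → Q x ≡ false) → any Q xs ≡ false
any-false []       _  = refl
any-false (x ∷ xs) ¬Q = cong₂ _∨_ (¬Q x (here refl)) (any-false xs (λ y y∈ → ¬Q y (there y∈)))

count-∈ : ∀ {A : Set} {Q : A → Bool} {x xs} → x ∈ xs → Q x ≡ true → 1 ≤ count Q xs
count-∈ {Q = Q} {x} {_ ∷ xs} (here refl) Qx = subst (λ b → 1 ≤ bit b ℕ.+ count Q xs) (sym Qx) (ℕ.s≤s ℕ.z≤n)
count-∈ {Q = Q} {x} {y ∷ xs} (there x∈)  Qx = ℕ.≤-trans (count-∈ {Q = Q} x∈ Qx) (ℕ.m≤n+m _ (bit (Q y)))

0<count⇒∃ : ∀ {A : Set} {Q : A → Bool} xs → 1 ≤ count Q xs → ∃ λ x → x ∈ xs × Q x ≡ true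
0<count⇒∃ {Q = Q} (x ∷ xs) le with Q x in eq
... | true  = x , here refl , eq
... | false with 0<count⇒∃ {Q = Q} xs le
...   | y , y∈ , Qy = y , there y∈ , Qy

count≡1⇒≡ : ∀ {A : Set} {Q : A → Bool} {x y xs} → count Q xs ≡ 1 →
  x ∈ xs → y ∈ xs → Q x ≡ true → Q y ≡ true → x ≡ y
count≡1⇒≡ _ (here refl) (here refl) _ _ = refl
count≡1⇒≡ {Q = Q} c (here refl) (there y∈) Qx Qy rewrite Qx =
  contradiction (subst (1 ≤_) (ℕ.suc-injective c) (count-∈ {Q = Q} y∈ Qy)) λ ()
count≡1⇒≡ {Q = Q} c (there x∈) (here refl) Qx Qy rewrite Qy =
  contradiction (subst (1 ≤_) (ℕ.suc-injective c) (count-∈ {Q = Q} x∈ Qx)) λ ()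
count≡1⇒≡ {Q = Q} {xs = z ∷ xs} c (there x∈) (there y∈) Qx Qy with Q z
... | false = count≡1⇒≡ {Q = Q} c x∈ y∈ Qx Qy
... | true  = contradiction (subst (1 ≤_) (ℕ.suc-injective c) (count-∈ {Q = Q} x∈ Qx)) λ ()

-- A Kraft inequality for objects revealed position by position

Σ-filter : ∀ {A : Set} (Q : A → Bool) xs g →
  Σ.over xs (λ x → ι (bit (Q x)) * g x) ≡ Σ.over (filter (λ x → Q x Bool.≟ true) xs) g
Σ-filter Q []       g = refl
Σ-filter Q (x ∷ xs) g with Q x
... | true  = cong₂ _+_ (trans (cong (_* g x) ι-1) (ℚ.*-identityˡ (g x))) (Σ-filter Q xs g)
... | false = trans (cong₂ _+_ (trans (cong (_* g x) ι-0) (ℚ.*-zeroˡ (g x))) (Σ-filter Q xs g)) (ℚ.+-identityˡ _)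

recip-pred-*-ι≤1 : ∀ k → recip (ℕ.pred k) * ι k ≤ℚ 1ℚ
recip-pred-*-ι≤1 zero    = ℚ.≤-trans (ℚ.≤-reflexive (trans (cong (recip 0 *_) ι-0) (ℚ.*-zeroʳ (recip 0)))) 0≤1ℚ
recip-pred-*-ι≤1 (suc k) = ℚ.≤-reflexive (trans (ℚ.*-comm (recip k) (ι (suc k))) (ι-recip k))

-- Objects in Good are determined by their cells, one true cell for each v.  They are revealed
-- one v after the other; N v x bounds the number of values that x may take at v
-- given the values at the positions before v.
module Kraft {n : ℕ} {X V : Set} (cell available : V → X → Fin n → Bool) (_≺_ : V → V → Set) (Good : X → Set)
  (one : ∀ {x} → Good x → ∀ v → count (cell v x) (allFin n) ≡ 1)
  (sound : ∀ {x} → Good x → ∀ v t → cell v x t ≡ true → available v x t ≡ true)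
  (local : ∀ {x y} v → (∀ u → u ≺ v → ∀ t → cell u x t ≡ cell u y t) → ∀ t → available v x t ≡ available v y t)
  (extensional : ∀ {x y} → (∀ v t → cell v x t ≡ cell v y t) → x ≡ y)
  (irreflexive : ∀ {v} → ¬ v ≺ v) where

  N : V → X → ℕ
  N v x = count (available v x) (allFin n)

  weight : V → X → ℚ
  weight v x = recip (ℕ.pred (N v x))

  private
    Agree : V → X → X → Set
    Agree v x y = ∀ t → cell v x t ≡ cell v y t

    common⇒Agree : ∀ {x y} v t → Good x → Good y → cell v x t ≡ true → cell v y t ≡ true → Agree v x y
    common⇒Agree {x} {y} v t Gx Gy cx cy s with cell v x s in ex | cell v y s in ey
    ... | true  | true  = refl
    ... | false | false = refl
    ... | true  | false with refl ← count≡1⇒≡ {Q = cell v x} (one Gx v) (∈-allFin s) (∈-allFin t) ex cx =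
      trans (sym cy) ey
    ... | false | true  with refl ← count≡1⇒≡ {Q = cell v y} (one Gy v) (∈-allFin s) (∈-allFin t) ey cy =
      trans (sym ex) cx

  -- Induction on the positions `vs` still hidden; members of `S` agree at all others. No hidden
  -- position precedes the first one, `v`, so all members share `available v` and the weight there.
  -- Splitting by the value at `v` gives at most N branches, each of sum at most 1. With nothing
  -- hidden, `S` has at most one member.
  kraft : ∀ vs (S : List X) → Unique S → (∀ x → x ∈ S → Good x) →
    AllPairs (λ v w → ¬ w ≺ v) vs →
    (∀ x y → x ∈ S → y ∈ S → ∀ u → u ∈ vs ⊎ Agree u x y) →
    Σ.over S (λ x → Π.over vs (λ v → weight v x)) ≤ℚ 1ℚ
  kraft _  []           _ _ _ _ = 0≤1ℚ
  kraft [] (x ∷ [])     _ _ _ _ = ℚ.≤-reflexive (ℚ.+-identityʳ 1ℚ)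
  kraft [] (x ∷ y ∷ S)  ((x≢y ∷ _) ∷ _) _ _ agree = contradiction (extensional x≈y) x≢y
    where
    x≈y : ∀ v → Agree v x y
    x≈y v with agree x y (here refl) (there (here refl)) v
    ... | inj₂ e = e
  kraft (v ∷ vs) S@(x₀ ∷ _) S! good (v-first ∷ sorted) agree = begin
    Σ.over S (λ x → weight v x * P x)                 ≡⟨ Σ.over-cong S (λ x x∈ → cong (_* P x) (weight≡ x x∈)) ⟩
    Σ.over S (λ x → weight v x₀ * P x)                ≡⟨ *-distribˡ-Σ (weight v x₀) S P ⟨
    weight v x₀ * Σ.over S P                          ≤⟨ *-monoˡ (0≤recip (ℕ.pred (N v x₀))) ΣP≤ ⟩
    weight v x₀ * ι (N v x₀)                          ≤⟨ recip-pred-*-ι≤1 (N v x₀) ⟩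
    1ℚ                                                ∎
    where
    open ℚ.≤-Reasoning
    P : X → ℚ
    P x = Π.over vs (λ w → weight w x)

    available≡ : ∀ x → x ∈ S → ∀ t → available v x t ≡ available v x₀ t
    available≡ x x∈ = local v agree-before
      where
      agree-before : ∀ u → u ≺ v → Agree u x x₀
      agree-before u u≺v with agree x x₀ x∈ (here refl) u
      ... | inj₁ (here refl) = contradiction u≺v irreflexive
      ... | inj₁ (there u∈)  = contradiction u≺v (All.lookup v-first u∈)
      ... | inj₂ e           = e

    weight≡ : ∀ x → x ∈ S → weight v x ≡ weight v x₀
    weight≡ x x∈ = cong (recip ∘ ℕ.pred) (#.over-cong (allFin n) (λ t _ → cong bit (available≡ x x∈ t)))

    branch : Fin n → List X
    branch t = filter (λ x → cell v x t Bool.≟ true) S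

    branch≤ : ∀ t b → available v x₀ t ≡ b → Σ.over (branch t) P ≤ℚ ι (bit b) * 1ℚ
    branch≤ t true  _  = ℚ.≤-trans
      (kraft vs (branch t) (Unique.filter⁺ (λ x → cell v x t Bool.≟ true) S!) good′ sorted agree′)
      (ℚ.≤-reflexive (sym (trans (ℚ.*-identityʳ (ι 1)) ι-1)))
      where
      ∈-branch : ∀ {x} → x ∈ branch t → x ∈ S × cell v x t ≡ true
      ∈-branch = ∈-filter⁻ (λ x → cell v x t Bool.≟ true) {xs = S}
      good′ : ∀ x → x ∈ branch t → Good x
      good′ x x∈ = good x (proj₁ (∈-branch x∈))
      agree′ : ∀ x y → x ∈ branch t → y ∈ branch t → ∀ u → u ∈ vs ⊎ Agree u x y
      agree′ x y x∈ y∈ u with agree x y (proj₁ (∈-branch x∈)) (proj₁ (∈-branch y∈)) u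
      ... | inj₁ (here refl) = inj₂ (common⇒Agree v t (good′ x x∈) (good′ y y∈) (proj₂ (∈-branch x∈)) (proj₂ (∈-branch y∈)))
      ... | inj₁ (there u∈)  = inj₁ u∈
      ... | inj₂ e           = inj₂ e
    branch≤ t false unavailable = begin
      Σ.over (branch t) P           ≤⟨ Σ-mono (branch t) {P} {λ _ → 0ℚ} (λ x x∈ → contradiction (x-available x x∈) λ ()) ⟩
      Σ.over (branch t) (λ _ → 0ℚ)  ≡⟨ Σ.over-ε (branch t) ⟩
      0ℚ                            ≡⟨ trans (ℚ.*-identityʳ (ι 0)) ι-0 ⟨
      ι 0 * 1ℚ                      ∎
      where
      x-available : ∀ x → x ∈ branch t → false ≡ true
      x-available x x∈ with ∈-filter⁻ (λ x → cell v x t Bool.≟ true) {xs = S} x∈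
      ... | x∈S , cx = trans (sym unavailable) (trans (sym (available≡ x x∈S t)) (sound (good x x∈S) v t cx))

    ΣP≤ : Σ.over S P ≤ℚ ι (N v x₀)
    ΣP≤ = begin
      Σ.over S P
        -- Each member is counted through its single true cell at `v`, so exchanging the sums splits
        -- `S` into its branches.
        ≡⟨ Σ.over-cong S (λ x x∈ → trans (sym (ℚ.*-identityˡ (P x))) (cong (_* P x) (sym (trans (cong ι (one (good x x∈) v)) ι-1)))) ⟩
      Σ.over S (λ x → ι (count (cell v x) (allFin n)) * P x)
        ≡⟨ Σ.over-cong S (λ x _ → sym (Σ-bits (allFin n) (cell v x) (P x))) ⟩
      Σ.over S (λ x → Σ.over (allFin n) (λ t → ι (bit (cell v x t)) * P x))
        ≡⟨ Σ.over-swap S (allFin n) (λ x t → ι (bit (cell v x t)) * P x) ⟩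
      Σ.over (allFin n) (λ t → Σ.over S (λ x → ι (bit (cell v x t)) * P x))
        ≡⟨ Σ.over-cong (allFin n) (λ t _ → Σ-filter (λ x → cell v x t) S P) ⟩
      Σ.over (allFin n) (λ t → Σ.over (branch t) P)
        ≤⟨ Σ-mono (allFin n) (λ t _ → branch≤ t (available v x₀ t) refl) ⟩
      Σ.over (allFin n) (λ t → ι (bit (available v x₀ t)) * 1ℚ)
        ≡⟨ trans (Σ-bits (allFin n) (available v x₀) 1ℚ) (ℚ.*-identityʳ (ι (N v x₀))) ⟩
      ι (N v x₀) ∎

-- Latin arrays

AllPairs-cartesianProductWith : ∀ {A B C : Set} {R : A → A → Set} {S : B → B → Set} {T : C → C → Set} {φ : A → B → C} →
  (∀ x {y y′} → S y y′ → T (φ x y) (φ x y′)) → (∀ {x x′} → R x x′ → ∀ y y′ → T (φ x y) (φ x′ y′)) →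
  ∀ {xs ys} → AllPairs R xs → AllPairs S ys → AllPairs T (cartesianProductWith φ xs ys)
AllPairs-cartesianProductWith inner outer []         ys! = []
AllPairs-cartesianProductWith {φ = φ} inner outer {x ∷ xs} {ys} (x∼ ∷ xs!) ys! = AllPairs.++⁺
  (AllPairs.map⁺ (AllPairs.map (inner x) ys!))
  (AllPairs-cartesianProductWith inner outer xs! ys!)
  (All.map⁺ (All.tabulate λ {y} _ → All.tabulate λ z∈ → across y z∈))
  where
  across : ∀ y {z} → z ∈ cartesianProductWith φ xs ys → _
  across y z∈ with ∈-cartesianProductWith⁻ φ xs ys z∈
  ... | x′ , y′ , x′∈ , _ , refl = outer (All.lookup x∼ x′∈) y y′

ι-length-cartesianProductWith : ∀ {A B C : Set} (φ : A → B → C) xs ys →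
  ι (length (cartesianProductWith φ xs ys)) ≡ ι (length xs) * ι (length ys)
ι-length-cartesianProductWith φ xs ys = begin
  ι (length (cartesianProductWith φ xs ys))                ≡⟨ ℚ.*-identityʳ _ ⟨
  ι (length (cartesianProductWith φ xs ys)) * 1ℚ           ≡⟨ Σ-const (cartesianProductWith φ xs ys) 1ℚ ⟨
  Σ.over (cartesianProductWith φ xs ys) (λ _ → 1ℚ)         ≡⟨ Σ.over-cartesianProductWith φ xs ys (λ _ → 1ℚ) ⟩
  Σ.over xs (λ _ → Σ.over ys (λ _ → 1ℚ))                   ≡⟨ Σ-const xs _ ⟩
  ι (length xs) * Σ.over ys (λ _ → 1ℚ)                     ≡⟨ cong (ι (length xs) *_) (trans (Σ-const ys 1ℚ) (ℚ.*-identityʳ _)) ⟩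
  ι (length xs) * ι (length ys)                            ∎
  where open ≡-Reasoning

ones-tabulate : ∀ {A : Set} {n} (Q : A → Bool) (h : Fin n → A) →
  ones (Vec.tabulate (Q ∘ h)) ≡ count Q (List.tabulate h)
ones-tabulate {n = zero}  Q h = refl
ones-tabulate {n = suc n} Q h with Q (h Fin.zero)
... | true  = cong suc (ones-tabulate Q (h ∘ Fin.suc))
... | false = ones-tabulate Q (h ∘ Fin.suc)

allVecs-Unique : ∀ {A : Set} {xs : List A} → Unique xs → ∀ n → Unique (allVecs xs n)
allVecs-Unique xs! zero    = [] ∷ []
allVecs-Unique xs! (suc n) = Unique.cartesianProductWith⁺ _∷_ Vec.∷-injective xs! (allVecs-Unique xs! n)

allArrays-Unique : ∀ n m → Unique (allArrays n m)
allArrays-Unique n zero    = ((λ ()) ∷ []) ∷ ([] ∷ [])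
allArrays-Unique n (suc m) = allVecs-Unique (allArrays-Unique n m) n

lookup-extensional : ∀ {A : Set} {n} (u v : Vec A n) → (∀ i → Vec.lookup u i ≡ Vec.lookup v i) → u ≡ v
lookup-extensional u v e =
  trans (sym (Vec.tabulate∘lookup u)) (trans (Vec.tabulate-cong e) (Vec.tabulate∘lookup v))

module _ {n : ℕ} where

  open Order (Fin._≟_ {n})

  -- A permutation is read as the graph of a Latin array: the value at `v` is the `t` whose cell is
  -- true.
  cell : ∀ {d} → Vec (Fin n) d → Array n (suc d) → Fin n → Bool
  cell {d} v P t = entry P (Vec.insertAt v (fromℕ d) t)

  cell-extensional : ∀ {d} {P Q : Array n (suc d)} → (∀ v t → cell v P t ≡ cell v Q t) → P ≡ Q
  cell-extensional {zero}  {P} {Q} e = lookup-extensional P Q (e [])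
  cell-extensional {suc d} {P} {Q} e =
    lookup-extensional P Q (λ i → cell-extensional (λ v → e (i ∷ v)))

  count-line : ∀ {d} (P : Array n (suc d)) v → ones (line P (fromℕ d) v) ≡ count (cell v P) (allFin n)
  count-line P v = ones-tabulate (cell v P) id

  count-cell : ∀ {d} {P : Array n (suc d)} → IsPermutation d P → ∀ v → count (cell v P) (allFin n) ≡ 1
  count-cell {d} {P} perm v = trans (sym (count-line P v)) (perm (fromℕ d) v)

  module _ {d : ℕ} {P : Array n (suc (suc d))} (perm : IsPermutation (suc d) P) where

    IsPermutation-lookup : ∀ a → IsPermutation d (Vec.lookup P a)
    IsPermutation-lookup a j v = perm (Fin.suc j) (a ∷ v)

    count-column : ∀ v t → count (λ c → cell v (Vec.lookup P c) t) (allFin n) ≡ 1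
    count-column v t = trans (sym (ones-tabulate (λ c → cell v (Vec.lookup P c) t) id))
      (perm Fin.zero (Vec.insertAt v (fromℕ d) t))

  -- σₖ is an order of the k-th coordinate; Earlier σs u v if u and v differ in one
  -- coordinate only, where u comes first.
  data Earlier : ∀ {d} → Vec (List (Fin n)) d → Vec (Fin n) d → Vec (Fin n) d → Set where
    here  : ∀ {d} {σ : List (Fin n)} {σs : Vec (List (Fin n)) d} {c a v} →
            c ∈ before a σ → Earlier (σ ∷ σs) (c ∷ v) (a ∷ v)
    there : ∀ {d} {σ : List (Fin n)} {σs : Vec (List (Fin n)) d} {a u v} →
            Earlier σs u v → Earlier (σ ∷ σs) (a ∷ u) (a ∷ v)

  ∉-before : ∀ a σ → ¬ a ∈ before a σ
  ∉-before a (x ∷ σ) p with x Fin.≟ a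
  ∉-before a (x ∷ σ) (here a≡x) | no x≢a = x≢a (sym a≡x)
  ∉-before a (x ∷ σ) (there p)  | no x≢a = ∉-before a σ p

  Earlier-irreflexive : ∀ {d} {σs : Vec (List (Fin n)) d} {v} → ¬ Earlier σs v v
  Earlier-irreflexive (here {σ = σ} {a = a} p) = ∉-before a σ p
  Earlier-irreflexive (there p)                = Earlier-irreflexive p

  before-sorted : ∀ {σ} → Unique σ → AllPairs (λ x y → x ≢ y × ¬ y ∈ before x σ) σ
  before-sorted {[]}    []         = []
  before-sorted {z ∷ σ} (z∉ ∷ σ!) =
    All.map (λ z≢y → z≢y , z-first) z∉ ∷ go σ (All.tabulate id) (before-sorted σ!)
    where
    z-first : ∀ {y} → ¬ y ∈ before z (z ∷ σ)
    z-first {y} p with z Fin.≟ z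
    ... | no z≢z = z≢z refl
    after-z : ∀ {x y} → y ∈ σ → ¬ y ∈ before x σ → ¬ y ∈ before x (z ∷ σ)
    after-z {x} y∈ y∉ p with z Fin.≟ x
    after-z {x} y∈ y∉ (here refl) | no _ = All.lookup z∉ y∈ refl
    after-z {x} y∈ y∉ (there p)   | no _ = y∉ p
    go : ∀ τ → All (_∈ σ) τ → AllPairs (λ x y → x ≢ y × ¬ y ∈ before x σ) τ →
      AllPairs (λ x y → x ≢ y × ¬ y ∈ before x (z ∷ σ)) τ
    go []      _        _         = []
    go (x ∷ τ) (_ ∷ τ⊆) (x∼ ∷ τ!) =
      All.zipWith (λ { (y∈ , (x≢y , y∉)) → x≢y , after-z y∈ y∉ }) (τ⊆ , x∼) ∷ go τ τ⊆ τ!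

  schedule : ∀ {d} → Vec (List (Fin n)) d → List (Vec (Fin n) d)
  schedule []       = [] ∷ []
  schedule (σ ∷ σs) = cartesianProductWith _∷_ σ (schedule σs)

  Orders : ∀ {d} → Vec (List (Fin n)) d → Set
  Orders σs = ∀ k → Vec.lookup σs k ↭ allFin n

  -- A position that differs in a single coordinate, and comes first there, also comes first
  -- lexicographically.
  schedule-sorted : ∀ {d} {σs : Vec (List (Fin n)) d} → Orders σs →
    AllPairs (λ v w → ¬ Earlier σs w v) (schedule σs)
  schedule-sorted {σs = []}     _      = [] ∷ []
  schedule-sorted {σs = σ ∷ σs} orders = AllPairs-cartesianProductWith
    (λ { x ¬e (here p) → ∉-before x σ p ; x ¬e (there e) → ¬e e })
    (λ { (x≢y , y∉) _ _ (here p) → y∉ p ; (x≢y , y∉) _ _ (there _) → x≢y refl })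
    (before-sorted (Unique-resp-↭ (↭-sym (orders Fin.zero)) (Unique.allFin⁺ n)))
    (schedule-sorted (λ k → orders (Fin.suc k)))

  ∈-schedule : ∀ {d} {σs : Vec (List (Fin n)) d} → Orders σs → ∀ v → v ∈ schedule σs
  ∈-schedule {σs = []}     _      []      = here refl
  ∈-schedule {σs = σ ∷ σs} orders (a ∷ v) = ∈-cartesianProductWith⁺ _∷_
    (↭.∈-resp-↭ (↭-sym (orders Fin.zero)) (∈-allFin a)) (∈-schedule {σs = σs} (λ k → orders (Fin.suc k)) v)

  Π-schedule : ∀ {d} {σs : Vec (List (Fin n)) d} → Orders σs → ∀ g →
    Π.over (schedule σs) g ≡ Π.over (indices n d) g
  Π-schedule {σs = []}     _      g = refl
  Π-schedule {suc d} {σ ∷ σs} orders g = begin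
    Π.over (schedule (σ ∷ σs)) g                                             ≡⟨ Π.over-cartesianProductWith _∷_ σ (schedule σs) g ⟩
    Π.over σ (λ a → Π.over (schedule σs) (λ v → g (a ∷ v)))                  ≡⟨ Π.over-↭ (orders Fin.zero) (λ a → Π.over (schedule σs) (λ v → g (a ∷ v))) ⟩
    Π.over (allFin n) (λ a → Π.over (schedule σs) (λ v → g (a ∷ v)))         ≡⟨ Π.over-cong (allFin n) (λ a _ → Π-schedule {σs = σs} (λ k → orders (Fin.suc k)) (λ v → g (a ∷ v))) ⟩
    Π.over (allFin n) (λ a → Π.over (indices n d) (λ v → g (a ∷ v)))         ≡⟨ Π.over-cartesianProductWith _∷_ (allFin n) (indices n d) g ⟨
    Π.over (indices n (suc d)) g                                             ∎
    where open ≡-Reasoning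

  -- No earlier cell on a line through the cell (v, t) of P is one; the lines in the last
  -- direction are not considered.
  free : ∀ {d} → Vec (List (Fin n)) d → Vec (Fin n) d → Array n (suc d) → Fin n → Bool
  free []       []      P t = true
  free (σ ∷ σs) (a ∷ v) P t =
    not (any (λ c → cell v (Vec.lookup P c) t) (before a σ)) ∧ free σs v (Vec.lookup P a) t

  any-cong : ∀ {Q R : Fin n → Bool} xs → (∀ x → x ∈ xs → Q x ≡ R x) → any Q xs ≡ any R xs
  any-cong []       e = refl
  any-cong (x ∷ xs) e = cong₂ _∨_ (e x (here refl)) (any-cong xs (λ y y∈ → e y (there y∈)))

  free-local : ∀ {d} {σs : Vec (List (Fin n)) d} {P Q} v →
    (∀ u → Earlier σs u v → ∀ t → cell u P t ≡ cell u Q t) → ∀ t → free σs v P t ≡ free σs v Q t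
  free-local {σs = []}     []      e t = refl
  free-local {σs = σ ∷ σs} (a ∷ v) e t = cong₂ (λ b c → not b ∧ c)
    (any-cong (before a σ) (λ c c∈ → e (c ∷ v) (here c∈) t))
    (free-local v (λ u u≺ → e (a ∷ u) (there u≺)) t)

  module _ {d : ℕ} {P : Array n (suc (suc d))} (perm : IsPermutation (suc d) P) where

    -- The line through this cell in the first direction has its only one at `a`, and `a` does not
    -- come before itself.
    first-free : ∀ {a v t} → cell (a ∷ v) P t ≡ true → ∀ σ → any (λ c → cell v (Vec.lookup P c) t) (before a σ) ≡ false
    first-free {a} {v} {t} cell≡ σ = any-false (before a σ) λ c c∈ → Bool.¬-not λ Pc →
      ∉-before a σ (subst (_∈ before a σ)
        (count≡1⇒≡ {Q = λ c → cell v (Vec.lookup P c) t} (count-column perm v t) (∈-allFin c) (∈-allFin a) Pc cell≡) c∈)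

  free-cell : ∀ {d} (σs : Vec (List (Fin n)) d) {P} → IsPermutation d P → ∀ v t → cell v P t ≡ true → free σs v P t ≡ true
  free-cell []       perm []      t _     = refl
  free-cell (σ ∷ σs) {P} perm (a ∷ v) t cell≡ = cong₂ (λ b c → not b ∧ c)
    (first-free perm {a} {v} cell≡ σ) (free-cell σs (IsPermutation-lookup perm a) v t cell≡)

  -- The number of free values under random orders

  bit-∧ : ∀ b c → bit (b ∧ c) ≡ bit b ℕ.* bit c
  bit-∧ false c = refl
  bit-∧ true  c = sym (ℕ.+-identityʳ (bit c))

  *-distribˡ-# : ∀ {A : Set} k (xs : List A) g → k ℕ.* #.over xs g ≡ #.over xs (λ x → k ℕ.* g x)
  *-distribˡ-# k []       g = ℕ.*-zeroʳ k
  *-distribˡ-# k (x ∷ xs) g = trans (ℕ.*-distribˡ-+ k (g x) _) (cong (k ℕ.* g x ℕ.+_) (*-distribˡ-# k xs g))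

  allOrders : ∀ d → List (Vec (List (Fin n)) d)
  allOrders = allVecs (permutations n (allFin n))

  ∈-allOrders : ∀ {d σs} → σs ∈ allOrders d → Orders σs
  ∈-allOrders {suc d} σs∈ k with ∈-cartesianProductWith⁻ _∷_ (permutations n (allFin n)) (allOrders d) σs∈
  ∈-allOrders {suc d} σs∈ Fin.zero    | σ , τs , σ∈ , τs∈ , refl = permutations-↭ n (List.length-tabulate id) σ∈
  ∈-allOrders {suc d} σs∈ (Fin.suc k) | σ , τs , σ∈ , τs∈ , refl = ∈-allOrders τs∈ k

  1≤∣allOrders∣ : ∀ d → 1ℚ ≤ℚ ι (length (allOrders d))
  1≤∣allOrders∣ zero    = ℚ.≤-reflexive (sym ι-1)
  1≤∣allOrders∣ (suc d) = begin
    1ℚ                                                           ≤⟨ *-mono (0≤ι _) 0≤1ℚ 1≤n!′ (1≤∣allOrders∣ d) ⟩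
    ι (length (permutations n (allFin n))) * ι (length (allOrders d))  ≡⟨ ι-length-cartesianProductWith _∷_ (permutations n (allFin n)) (allOrders d) ⟨
    ι (length (allOrders (suc d)))                               ∎
    where
    open ℚ.≤-Reasoning
    1≤n!′ : 1ℚ ≤ℚ ι (length (permutations n (allFin n)))
    1≤n!′ = begin
      1ℚ                                         ≡⟨ ι-1 ⟨
      ι 1                                        ≤⟨ ι-mono (ℕ.1≤n! n) ⟩
      ι (n !)                                    ≡⟨ length-permutations n (List.length-tabulate id) ⟨
      ι (length (permutations n (allFin n)))     ∎

  module _ (B : Fin n → Fin n → Bool) (rows : ∀ c → count (B c) (allFin n) ≡ 1)
    (columns : ∀ t → count (λ c → B c t) (allFin n) ≡ 1) (R : Fin n → Bool) where

    -- R transported along the bijection whose graph is B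
    image : Fin n → Bool
    image c = any (λ t → R t ∧ B c t) (allFin n)

    -- Double counting of the pairs (t, c) with `R t` and `B c t`. Each row of `B` has a single one,
    -- so a given `c` lies in at most one such pair.
    count-image : ∀ cs → #.over (allFin n) (λ t → bit (R t) ℕ.* count (λ c → B c t) cs) ≡ count image cs
    count-image cs = begin
      #.over (allFin n) (λ t → bit (R t) ℕ.* count (λ c → B c t) cs)
        ≡⟨ #.over-cong (allFin n) (λ t _ → *-distribˡ-# (bit (R t)) cs (λ c → bit (B c t))) ⟩
      #.over (allFin n) (λ t → #.over cs (λ c → bit (R t) ℕ.* bit (B c t)))
        ≡⟨ #.over-swap (allFin n) cs (λ t c → bit (R t) ℕ.* bit (B c t)) ⟩
      #.over cs (λ c → #.over (allFin n) (λ t → bit (R t) ℕ.* bit (B c t)))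
        ≡⟨ #.over-cong cs (λ c _ → trans
             (#.over-cong (allFin n) (λ t _ → sym (bit-∧ (R t) (B c t))))
             (count-≤1 (allFin n) (ℕ.≤-trans
               (count-mono (allFin n) (λ t e → Bool.∧-conicalʳ (R t) (B c t) e))
               (ℕ.≤-reflexive (rows c))))) ⟩
      count image cs ∎
      where open ≡-Reasoning

    count-R : count R (allFin n) ≡ count image (allFin n)
    count-R = trans
      (#.over-cong (allFin n) (λ t _ → sym (trans (cong (bit (R t) ℕ.*_) (columns t)) (ℕ.*-identityʳ _))))
      (count-image (allFin n))

    -- The column of `t` has a single one, so `t` survives exactly when that one lies in `from a σ`.
    -- Survival of values thus becomes a count along the order `σ`, to which `Σ-count-from` applies.
    count-R-free : ∀ a {σ} → σ ↭ allFin n →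
      count (λ t → R t ∧ not (any (λ c → B c t) (before a σ))) (allFin n) ≡ count image (from a σ)
    count-R-free a {σ} σ↭ = trans
      (#.over-cong (allFin n) (λ t _ → trans (bit-∧ (R t) _) (cong (bit (R t) ℕ.*_) (sym (after t)))))
      (count-image (from a σ))
      where
      complement : ∀ b {k} → bit b ℕ.+ k ≡ 1 → k ≡ bit (not b)
      complement true  e = ℕ.suc-injective e
      complement false e = e
      after : ∀ t → count (λ c → B c t) (from a σ) ≡ bit (not (any (λ c → B c t) (before a σ)))
      after t = complement _ (trans (cong (ℕ._+ count Q (from a σ)) (sym (count-≤1 (before a σ) before≤1))) split)
        where
        Q : Fin n → Bool
        Q c = B c t
        split : count Q (before a σ) ℕ.+ count Q (from a σ) ≡ 1
        split = trans (sym (#.over-++ (before a σ) (from a σ) (bit ∘ Q)))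
          (trans (cong (count Q) (before++from a σ)) (trans (#.over-↭ σ↭ (bit ∘ Q)) (columns t)))
        before≤1 : count Q (before a σ) ≤ 1
        before≤1 = subst (count Q (before a σ) ≤_) split (ℕ.m≤m+n _ _)

  module _ (F : ℕ → ℕ → ℚ) (rec : ∀ d q → ι (suc q) * F (suc d) (suc q) ≡ ι q * F (suc d) q + F d (suc q)) where

    -- The lines in the first direction leave a uniform number of the values in R free,
    -- and the lines in the other directions are then treated in the same way, independently.
    Σ-count-free : ∀ {d} {P : Array n (suc d)} → IsPermutation d P → ∀ v {t₀} → cell v P t₀ ≡ true →
      ∀ {R} → R t₀ ≡ true →
      Σ.over (allOrders d) (λ σs → F 0 (count (λ t → R t ∧ free σs v P t) (allFin n))) ≡
      ι (length (allOrders d)) * F d (count R (allFin n))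
    Σ-count-free {zero}  {P} perm []      cell≡ {R} R≡ = begin
      F 0 (count (λ t → R t ∧ true) (allFin n)) + 0ℚ    ≡⟨ ℚ.+-identityʳ _ ⟩
      F 0 (count (λ t → R t ∧ true) (allFin n))         ≡⟨ cong (F 0) (#.over-cong (allFin n) (λ t _ → cong bit (Bool.∧-identityʳ (R t)))) ⟩
      F 0 (count R (allFin n))                          ≡⟨ ℚ.*-identityˡ _ ⟨
      1ℚ * F 0 (count R (allFin n))                     ≡⟨ cong (_* F 0 (count R (allFin n))) ι-1 ⟨
      ι 1 * F 0 (count R (allFin n))                    ∎
      where open ≡-Reasoning
    Σ-count-free {suc d} {P} perm (a ∷ v) {t₀} cell≡ {R} R≡ = begin
      Σ.over (allOrders (suc d)) (λ σs → F 0 (count (λ t → R t ∧ free σs (a ∷ v) P t) (allFin n)))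
        ≡⟨ Σ.over-cartesianProductWith _∷_ (permutations n (allFin n)) (allOrders d)
             (λ σs → F 0 (count (λ t → R t ∧ free σs (a ∷ v) P t) (allFin n))) ⟩
      Σ.over (permutations n (allFin n)) (λ σ → Σ.over (allOrders d)
        (λ σs → F 0 (count (λ t → R t ∧ (first σ t ∧ free σs v (Vec.lookup P a) t)) (allFin n))))
        ≡⟨ Σ.over-cong (permutations n (allFin n)) (λ σ _ → Σ.over-cong (allOrders d) (λ σs _ → cong (F 0)
             (#.over-cong (allFin n) (λ t _ → cong bit (sym (Bool.∧-assoc (R t) (first σ t) (free σs v (Vec.lookup P a) t))))))) ⟩
      Σ.over (permutations n (allFin n)) (λ σ → Σ.over (allOrders d)
        (λ σs → F 0 (count (λ t → (R t ∧ first σ t) ∧ free σs v (Vec.lookup P a) t) (allFin n))))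
        -- In the slice of `P` at `a`, the values of `R` that survive `σ` take over the role of `R`;
        -- this is why `R` is arbitrary in the induction. The value `t₀` survives by `first-free`.
        ≡⟨ Σ.over-cong (permutations n (allFin n)) (λ σ _ →
             Σ-count-free (IsPermutation-lookup perm a) v {t₀} cell≡ {λ t → R t ∧ first σ t}
               (cong₂ _∧_ R≡ (cong not (first-free perm {a} {v} cell≡ σ)))) ⟩
      Σ.over (permutations n (allFin n)) (λ σ → W * F d (count (λ t → R t ∧ first σ t) (allFin n)))
        ≡⟨ Σ.over-cong (permutations n (allFin n)) (λ σ σ∈ → cong (λ q → W * F d q)
             (count-R-free B rows columns R a (permutations-↭ n (List.length-tabulate id) σ∈))) ⟩
      Σ.over (permutations n (allFin n)) (λ σ → W * F d (count Q (from a σ)))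
        ≡⟨ *-distribˡ-Σ W (permutations n (allFin n)) _ ⟨
      W * Σ.over (permutations n (allFin n)) (λ σ → F d (count Q (from a σ)))
        ≡⟨ cong (W *_) (Σ-count-from {F d} {F (suc d)} (rec d) {Q} Q≡ n (List.length-tabulate id) (Unique.allFin⁺ n) (∈-allFin a)) ⟩
      W * (ι (n !) * F (suc d) (count Q (allFin n)))
        ≡⟨ cong₂ (λ w q → W * (w * F (suc d) q)) (sym (length-permutations n (List.length-tabulate id))) (sym (count-R B rows columns R)) ⟩
      W * (ι (length (permutations n (allFin n))) * F (suc d) (count R (allFin n)))
        ≡⟨ solve 3 (λ a b c → a :* (b :* c) := b :* a :* c) refl W (ι (length (permutations n (allFin n)))) (F (suc d) (count R (allFin n))) ⟩
      ι (length (permutations n (allFin n))) * W * F (suc d) (count R (allFin n))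
        ≡⟨ cong (_* F (suc d) (count R (allFin n))) (ι-length-cartesianProductWith _∷_ (permutations n (allFin n)) (allOrders d)) ⟨
      ι (length (allOrders (suc d))) * F (suc d) (count R (allFin n)) ∎
      where
      open ≡-Reasoning
      W : ℚ
      W = ι (length (allOrders d))
      B : Fin n → Fin n → Bool
      B c t = cell v (Vec.lookup P c) t
      rows : ∀ c → count (B c) (allFin n) ≡ 1
      rows c = count-cell (IsPermutation-lookup perm c) v
      columns : ∀ t → count (λ c → B c t) (allFin n) ≡ 1
      columns = count-column perm v
      first : List (Fin n) → Fin n → Bool
      first σ t = not (any (λ c → B c t) (before a σ))
      -- `Q c` holds when the value of `P` at `c ∷ v` lies in `R`; it holds at `a` because of `t₀`.
      Q : Fin n → Bool
      Q = image B rows columns R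
      Q≡ : Q a ≡ true
      Q≡ = any-true {Q = λ t → R t ∧ B a t} (∈-allFin t₀) (cong₂ _∧_ R≡ cell≡)

-- The bound

opaque
  unfolding recip

  -- The definition of `f` uses the fraction itself and not the opaque `recip`.
  recip-def : ∀ s → ℤ.+ 1 ℚ./ suc s ≡ recip s
  recip-def s = refl

module _ (m : ℕ) where

  ∑-seq : ℕ → (ℕ → ℝ) → ℚ
  ∑-seq n g = seq (∑ {n} (λ i → g (toℕ i))) m

  -- `∑` splits off its first term, whereas the recursion in r needs the last one.
  ∑-seq-suc : ∀ n g → ∑-seq (suc n) g ≡ ∑-seq n g + seq (g n) m
  ∑-seq-suc zero    g = ℚ.+-comm (seq (g 0) m) (ι 0)
  ∑-seq-suc (suc n) g = trans
    (cong (seq (g 0) m +_) (∑-seq-suc n (g ∘ suc)))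
    (sym (ℚ.+-assoc (seq (g 0) m) _ _))

  0≤∑-seq : ∀ n {g} → (∀ k → 0ℚ ≤ℚ seq (g k) m) → 0ℚ ≤ℚ ∑-seq n g
  0≤∑-seq zero    0≤g = 0≤ι 0
  0≤∑-seq (suc n) {g} 0≤g = +-nonNeg (0≤g 0) (0≤∑-seq n {g ∘ suc} (0≤g ∘ suc))

  -- At q = 0, where f is undefined, this is the value at q = 1.
  fApprox : ℕ → ℕ → ℚ
  fApprox d q = seq (f d (suc (ℕ.pred q))) m

  -- Exact at every index m, since real addition and multiplication are termwise. The convention at
  -- q = 0 is harmless, as its coefficient is `ι 0`.
  fApprox-rec : ∀ d q → ι (suc q) * fApprox (suc d) (suc q) ≡ ι q * fApprox (suc d) q + fApprox d (suc q)
  fApprox-rec d q = begin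
    ι (suc q) * fApprox (suc d) (suc q)                              ≡⟨ scaled q ⟩
    ∑-seq (suc q) (λ k → f d (suc k))                                ≡⟨ ∑-seq-suc q (λ k → f d (suc k)) ⟩
    ∑-seq q (λ k → f d (suc k)) + fApprox d (suc q)                  ≡⟨ cong (_+ fApprox d (suc q)) (unscaled q) ⟩
    ι q * fApprox (suc d) q + fApprox d (suc q)                      ∎
    where
    open ≡-Reasoning
    scaled : ∀ q → ι (suc q) * fApprox (suc d) (suc q) ≡ ∑-seq (suc q) (λ k → f d (suc k))
    scaled q = trans (cong (λ r → ι (suc q) * (r * S)) (recip-def q))
      (trans (cong (ι (suc q) *_) (ℚ.*-comm (recip q) S)) (ι-suc-*-recip q S))
      where
      S : ℚ
      S = ∑-seq (suc q) (λ k → f d (suc k))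
    unscaled : ∀ q → ∑-seq q (λ k → f d (suc k)) ≡ ι q * fApprox (suc d) q
    unscaled zero    = trans ι-0 (sym (trans (cong (_* fApprox (suc d) 0) ι-0) (ℚ.*-zeroˡ (fApprox (suc d) 0))))
    unscaled (suc q) = sym (scaled q)

  0≤fApprox : ∀ d q → 0ℚ ≤ℚ fApprox d q
  0≤fApprox zero    q = 0≤logSum (ℕ.pred q) m
  0≤fApprox (suc d) q = subst (λ r → 0ℚ ≤ℚ r * ∑-seq (suc (ℕ.pred q)) (λ k → f d (suc k))) (sym (recip-def (ℕ.pred q)))
    (*-nonNeg (0≤recip (ℕ.pred q)) (0≤∑-seq (suc (ℕ.pred q)) {λ k → f d (suc k)} (λ k → 0≤fApprox d (suc k))))

  fApprox-≡ : ∀ d q .{{_ : ℕ.NonZero q}} → seq (f d q) m ≡ fApprox d q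
  fApprox-≡ d (suc q) = refl

  seq-∏ : ∀ {A : Set} (xs : List A) (g : A → ℝ) →
    seq (List.foldr (λ x p → g x *ℝ p) (fromℕℝ 1) xs) m ≡ Π.over xs (λ x → seq (g x) m)
  seq-∏ []       g = ι-1
  seq-∏ (x ∷ xs) g = cong (seq (g x) m *_) (seq-∏ xs g)

module _ (d n : ℕ) (A : Array (suc n) (suc d)) where

  private
    Good : Array (suc n) (suc d) → Set
    Good P = IsPermutation d P × Supports A P

    good? : ∀ P → Dec (Good P)
    good? P = isPermutation? d P ×-dec supports? A P

    S : List (Array (suc n) (suc d))
    S = filter good? (allArrays (suc n) (suc d))

    V : List (Vec (Fin (suc n)) d)
    V = indices (suc n) d

    Ω : List (Vec (List (Fin (suc n))) d)
    Ω = allOrders d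

    available : Vec (List (Fin (suc n))) d → Vec (Fin (suc n)) d → Array (suc n) (suc d) → Fin (suc n) → Bool
    available σs v P t = cell v A t ∧ free σs v P t

    N : Array (suc n) (suc d) → Vec (List (Fin (suc n))) d → Vec (Fin (suc n)) d → ℕ
    N P σs v = count (available σs v P) (allFin (suc n))

    w : Array (suc n) (suc d) → Vec (List (Fin (suc n))) d → Vec (Fin (suc n)) d → ℚ
    w P σs v = recip (ℕ.pred (N P σs v))

    supported : ∀ {P} → Good P → ∀ v t → cell v P t ≡ true → cell v A t ≡ true
    supported (_ , supp) v t = supp (Vec.insertAt v (fromℕ d) t)

    cell⇒available : ∀ σs {P} → Good P → ∀ v t → cell v P t ≡ true → available σs v P t ≡ true
    cell⇒available σs good v t cell≡ = cong₂ _∧_ (supported good v t cell≡) (free-cell σs (proj₁ good) v t cell≡)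

    value : ∀ {P} → Good P → ∀ v → ∃ λ t → cell v P t ≡ true
    value {P} good v with 0<count⇒∃ {Q = cell v P} (allFin (suc n)) (ℕ.≤-reflexive (sym (count-cell (proj₁ good) v)))
    ... | t , _ , cell≡ = t , cell≡

    0<N : ∀ {P} → Good P → ∀ σs v → 1 ≤ N P σs v
    0<N {P} good σs v with value good v
    ... | t , cell≡ = count-∈ {Q = available σs v P} (∈-allFin t) (cell⇒available σs good v t cell≡)

    kraft-free : ∀ σs → σs ∈ Ω → Σ.over S (λ P → Π.over V (w P σs)) ≤ℚ 1ℚ
    kraft-free σs σs∈ = begin
      Σ.over S (λ P → Π.over V (w P σs))                  ≡⟨ Σ.over-cong S (λ P _ → Π-schedule {σs = σs} orders (w P σs)) ⟨
      Σ.over S (λ P → Π.over (schedule σs) (w P σs))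
        ≤⟨ Kraft.kraft cell (available σs) (Earlier σs) Good
             (λ good → count-cell (proj₁ good))
             (cell⇒available σs)
             (λ v e t → cong (cell v A t ∧_) (free-local v e t))
             cell-extensional
             Earlier-irreflexive
             (schedule σs) S (Unique.filter⁺ good? (allArrays-Unique (suc n) (suc d)))
             (λ P P∈ → proj₂ (∈-filter⁻ good? {xs = allArrays (suc n) (suc d)} P∈))
             (schedule-sorted orders)
             (λ _ _ _ _ u → inj₁ (∈-schedule {σs = σs} orders u)) ⟩
      1ℚ                                                  ∎
      where
      open ℚ.≤-Reasoning
      orders : Orders σs
      orders = ∈-allOrders {suc n} {d} {σs} σs∈

  module _ {n₀ m : ℕ} (n₀≤m : n₀ ≤ m) where

    private
      -- `suc j` equals (n + 1)(n₀ + 1), the least exponent for which `ι≤[1+log/j]^j` covers all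
      -- counts up to n + 1, the order of the array.
      j : ℕ
      j = n₀ ℕ.+ n ℕ.* suc n₀
      r : Vec (Fin (suc n)) d → ℕ
      r v = count (cell v A) (allFin (suc n))
      g : Vec (Fin (suc n)) d → ℚ
      g v = 1ℚ + fApprox m d (r v) * recip j
      G W : ℚ
      G = Π.over V g ^ suc j
      W = ι (length Ω)
      1≤g : ∀ v → 1ℚ ≤ℚ g v
      1≤g v = p≤p+q (*-nonNeg (0≤fApprox m d (r v)) (0≤recip j))

      module _ {P} (good : Good P) where

        -- A rational upper bound for the root of N of order `suc j`, affine in the approximate
        -- logarithm so that its mean can be computed exactly.
        h : Vec (List (Fin (suc n))) d → Vec (Fin (suc n)) d → ℚ
        h σs v = 1ℚ + (fApprox m 0 (N P σs v) + recip n₀) * recip j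

        1≤hᴶw : ∀ σs v → 1ℚ ≤ℚ h σs v ^ suc j * w P σs v
        1≤hᴶw σs v = bound (N P σs v) (0<N good σs v)
          (ℕ.≤-trans (count-≤-length (available σs v P) (allFin (suc n))) (ℕ.≤-reflexive (List.length-tabulate id)))
          where
          open ℚ.≤-Reasoning
          bound : ∀ k → 1 ≤ k → k ≤ suc n →
            1ℚ ≤ℚ (1ℚ + (fApprox m 0 k + recip n₀) * recip j) ^ suc j * recip (ℕ.pred k)
          bound (suc s) _ s≤n = begin
            1ℚ                      ≡⟨ ι-recip s ⟨
            ι (suc s) * recip s     ≤⟨ *-monoʳ (0≤recip s) (ι≤[1+log/j]^j s n₀ n₀≤m (ℕ.*-monoˡ-≤ (suc n₀) s≤n)) ⟩
            (1ℚ + (fApprox m 0 (suc s) + recip n₀) * recip j) ^ suc j * recip s ∎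

        Σh≡ : ∀ v → Σ.over Ω (λ σs → h σs v) ≡ W * (g v + recip n₀ * recip j)
        Σh≡ v = begin
          Σ.over Ω (λ σs → h σs v)
            ≡⟨ Σ.over-∙ Ω (λ _ → 1ℚ) (λ σs → (fApprox m 0 (N P σs v) + recip n₀) * recip j) ⟩
          Σ.over Ω (λ _ → 1ℚ) + Σ.over Ω (λ σs → (fApprox m 0 (N P σs v) + recip n₀) * recip j)
            ≡⟨ cong₂ _+_ (Σ-const Ω 1ℚ) (sym (*-distribʳ-Σ (recip j) Ω (λ σs → fApprox m 0 (N P σs v) + recip n₀))) ⟩
          W * 1ℚ + Σ.over Ω (λ σs → fApprox m 0 (N P σs v) + recip n₀) * recip j
            ≡⟨ cong (λ z → W * 1ℚ + z * recip j) (trans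
                 (Σ.over-∙ Ω (λ σs → fApprox m 0 (N P σs v)) (λ _ → recip n₀))
                 (cong₂ _+_ Σℓ≡ (Σ-const Ω (recip n₀)))) ⟩
          W * 1ℚ + (W * fApprox m d (r v) + W * recip n₀) * recip j
            ≡⟨ solve 4 (λ w x e i → w :* con 1ℚ :+ (w :* x :+ w :* e) :* i := w :* (con 1ℚ :+ x :* i :+ e :* i)) refl W (fApprox m d (r v)) (recip n₀) (recip j) ⟩
          W * (g v + recip n₀ * recip j) ∎
          where
          open ≡-Reasoning
          Σℓ≡ : Σ.over Ω (λ σs → fApprox m 0 (N P σs v)) ≡ W * fApprox m d (r v)
          Σℓ≡ with value good v
          ... | t , cell≡ = Σ-count-free (fApprox m) (fApprox-rec m) (proj₁ good) v cell≡ {cell v A} (supported good v t cell≡)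

        jensen-free : W * (1ℚ - ι (length V) * recip n₀) ≤ℚ G * Σ.over Ω (λ σs → Π.over V (w P σs))
        -- The factor `ι (suc j)` from `jensen` cancels the `recip j` in the error, so only
        -- `recip n₀` is left.
        jensen-free = subst (λ e → W * (1ℚ - ι (length V) * e) ≤ℚ G * Σ.over Ω (λ σs → Π.over V (w P σs)))
          (ι-suc-*-recip j (recip n₀))
          (jensen V (suc j) Ω g (w P) h (recip n₀ * recip j)
            1≤g
            (λ σs v → 0≤recip _)
            (λ σs v → +-nonNeg 0≤1ℚ (*-nonNeg (+-nonNeg (0≤fApprox m 0 (N P σs v)) (0≤recip n₀)) (0≤recip j)))
            (*-nonNeg (0≤recip n₀) (0≤recip j))
            (λ σs _ v → 1≤hᴶw σs v)
            (λ v → ℚ.≤-reflexive (Σh≡ v)))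

    -- `jensen-free` bounds each P by an average over the orders; after the sums are exchanged,
    -- `kraft-free` bounds the sum over P for each order. The number `W` of orders then cancels.
    Per-bound : ι (Per d A) * (1ℚ - ι (length V) * recip n₀) ≤ℚ G
    Per-bound = ℚ.*-cancelˡ-≤-pos W {{ℚ.positive (ℚ.<-≤-trans (ℚ.positive⁻¹ 1ℚ) (1≤∣allOrders∣ {suc n} d))}} (begin
      W * (ι (Per d A) * c)                                       ≡⟨ solve 3 (λ w p c → w :* (p :* c) := p :* (w :* c)) refl W (ι (Per d A)) c ⟩
      ι (Per d A) * (W * c)                                       ≡⟨ Σ-const S (W * c) ⟨
      Σ.over S (λ _ → W * c)                                      ≤⟨ Σ-mono S {λ _ → W * c} (λ P P∈ → jensen-free {P} (proj₂ (∈-filter⁻ good? {xs = allArrays (suc n) (suc d)} P∈))) ⟩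
      Σ.over S (λ P → G * Σ.over Ω (λ σs → Π.over V (w P σs)))    ≡⟨ *-distribˡ-Σ G S (λ P → Σ.over Ω (λ σs → Π.over V (w P σs))) ⟨
      G * Σ.over S (λ P → Σ.over Ω (λ σs → Π.over V (w P σs)))    ≡⟨ cong (G *_) (Σ.over-swap S Ω (λ P σs → Π.over V (w P σs))) ⟩
      G * Σ.over Ω (λ σs → Σ.over S (λ P → Π.over V (w P σs)))    ≤⟨ *-monoˡ 0≤G (Σ-mono Ω kraft-free) ⟩
      G * Σ.over Ω (λ _ → 1ℚ)                                     ≡⟨ cong (G *_) (trans (Σ-const Ω 1ℚ) (ℚ.*-identityʳ W)) ⟩
      G * W                                                       ≡⟨ ℚ.*-comm G W ⟩
      W * G                                                       ∎)
      where
      open ℚ.≤-Reasoning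
      c : ℚ
      c = 1ℚ - ι (length V) * recip n₀
      0≤G : 0ℚ ≤ℚ G
      0≤G = ^-nonNeg (Π-nonNeg V (λ v _ → ℚ.≤-trans 0≤1ℚ (1≤g v))) (suc j)

    Per-bound-exp : suc (suc j) ≤ m →
      ι (Per d A) ≤ℚ Π.over V (λ v → expSum (fApprox m d (r v)) m) + ι (Per d A) * ι (length V) * recip n₀
    Per-bound-exp j<m = begin
      p                                                ≡⟨ solve 3 (λ p k e → p := p :* (con 1ℚ :- k :* e) :+ p :* k :* e) refl p (ι (length V)) (recip n₀) ⟩
      p * (1ℚ - ι (length V) * recip n₀) + error       ≤⟨ ℚ.+-monoˡ-≤ error Per-bound ⟩
      G + error                                        ≡⟨ cong (_+ error) (Π-^ V g (suc j)) ⟨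
      Π.over V (λ v → g v ^ suc j) + error
        ≤⟨ ℚ.+-monoˡ-≤ error (Π-mono V (λ v _ → ^-nonNeg (ℚ.≤-trans 0≤1ℚ (1≤g v)) (suc j))
             (λ v _ → [1+x/j]^j≤expSum (0≤fApprox m d (r v)) j<m)) ⟩
      Π.over V (λ v → expSum (fApprox m d (r v)) m) + error ∎
      where
      open ℚ.≤-Reasoning
      p error : ℚ
      p = ι (Per d A)
      error = p * ι (length V) * recip n₀

  seq-∏-exp : ∀ m (r≥1 : ∀ v → 1 ≤ lastLineOnes d A v) →
    seq ((∏[ suc n ]^ d) (λ v → expℝ (f d (lastLineOnes d A v) {{>-nonZero (r≥1 v)}}))) m
      ≡ Π.over V (λ v → expSum (fApprox m d (count (cell v A) (allFin (suc n)))) m)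
  seq-∏-exp m r≥1 = trans
    (seq-∏ m V (λ v → expℝ (f d (lastLineOnes d A v) {{>-nonZero (r≥1 v)}})))
    (Π.over-cong V (λ v _ → cong (λ x → expSum x m) (trans
      (fApprox-≡ m d (lastLineOnes d A v) {{>-nonZero (r≥1 v)}})
      (cong (fApprox m d) (count-line A v)))))

theorem1p6 : (d n : ℕ) → 1 ≤ d → 1 ≤ n → (A : Array n (suc d)) →
    (r≥1 : (v : Vec (Fin n) d) → 1 ≤ lastLineOnes d A v) →
    fromℕℝ (Per d A) ≤ℝ
    (∏[ n ]^ d) (λ v → expℝ (f d (lastLineOnes d A v) {{>-nonZero (r≥1 v)}}))
theorem1p6 d (suc n) _ _ A r≥1 ε 0<ε = suc (suc j) , λ m j<m → ℚ.≤-trans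
  (Per-bound-exp d n A (ℕ.≤-trans (ℕ.m≤n⇒m≤o+n 2 (ℕ.m≤m+n n₀ (n ℕ.* suc n₀))) j<m) j<m)
  (ℚ.+-mono-≤ (ℚ.≤-reflexive (sym (seq-∏-exp d n A m r≥1))) (proj₂ small))
  where
  -- `n₀` is fixed before the index m, so that the error is at most ε. The condition m ≥ j + 2 then
  -- lets m terms of the exponential series dominate the power with exponent j + 1, and it implies
  -- n₀ ≤ m.
  small : ∃ λ n₀ → ι (Per d A) * ι (length (indices (suc n) d)) * recip n₀ ≤ℚ ε
  small = eventually-small (ι (Per d A) * ι (length (indices (suc n) d))) 0<ε
  n₀ j : ℕ
  n₀ = proj₁ small
  j = n₀ ℕ.+ n ℕ.* suc n₀
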